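{- Let $d\ge 2$ be an integer. In $\mathbb{R}^d$ there exists a strictly antipodal set, affinely spanning $\mathbb{R}^d$, of cardinality $$4^{\lfloor d/3 \rfloor} \geq \mathrm{const} \cdot (4^{1/3})^d = \mathrm{const} \cdot 1.5874\ldots^d,$$ where $\mathrm{const}>0$ is an absolute constant.
   Context: Let $X\subset\mathbb{R}^d$ be a finite set with affine hull $\mathbb{R}^d$, and let $P=\operatorname{conv}X$ be its convex hull. Two distinct points $x,y\in X$ are strictly antipodal (in $X$) if there are different parallel supporting hyperplanes $H',H''$ of $P$ with $X\cap H'=\{x\}$ and $X\cap H''=\{y\}$. The set $X$ is called strictly antipodal if each pair of distinct points of $X$ is strictly antipodal in $X$.
   Formalization: For d = 2, 4, 5 no set of exactly 4^⌊d/3⌋ points affinely spans ℝ^d (it has fewer than d+1 points); there the cardinality is only claimed to be at least 4^⌊d/3⌋, and it is exactly 4^⌊d/3⌋ for all other d ≥ 2. -}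

module Defs where

open import Algebra.Bundles.Raw using (RawSemiring)
import Algebra.Definitions.RawSemiring as RawSemiringDefinitions
open import Data.Fin.Base using (Fin)
import Data.Integer.Base as ℤ
open import Data.Nat.Base as ℕ using (ℕ; _⊔_)
import Data.Nat.Properties as ℕ
open import Data.Product.Base using (_×_; _,_; ∃-syntax)
open import Data.Rational.Base as ℚ using (ℚ; 0ℚ; 1ℚ; ½; ∣_∣)
import Data.Rational.Properties as ℚ
open import Data.Rational.Solver using (module +-*-Solver)
open import Data.Sum.Base using (_⊎_)
open import Data.Vec.Functional using (Vector; zipWith)
open import Function.Definitions using (Injective)
open import Level using (0ℓ)
open import Relation.Binary.PropositionalEquality
  using (_≡_; refl; sym; trans; cong; subst)
open import Relation.Nullary.Negation.Core using (¬_)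
open import Relation.Unary using (Pred; _∈_; _⊆_; _∩_; _≐_)

-- Real numbers, as Cauchy sequences of rationals (with modulus, since
-- the existential is a Σ-type) under the setoid equality _≈_.

Cauchy : (ℕ → ℚ) → Set
Cauchy s = ∀ ε → 0ℚ ℚ.< ε →
  ∃[ N ] (∀ m n → N ℕ.≤ m → N ℕ.≤ n → ∣ s m ℚ.- s n ∣ ℚ.< ε)

record ℝ : Set where
  constructor mkℝ
  field
    seq    : ℕ → ℚ
    cauchy : Cauchy seq

open ℝ public

infix 4 _≈_ _<_ _≤_

_≈_ : ℝ → ℝ → Set
x ≈ y = ∀ ε → 0ℚ ℚ.< ε →
  ∃[ N ] (∀ n → N ℕ.≤ n → ∣ seq x n ℚ.- seq y n ∣ ℚ.< ε)

_<_ : ℝ → ℝ → Set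
x < y = ∃[ ε ] (0ℚ ℚ.< ε ×
  ∃[ N ] (∀ n → N ℕ.≤ n → seq x n ℚ.+ ε ℚ.< seq y n))

_≤_ : ℝ → ℝ → Set
x ≤ y = ∀ ε → 0ℚ ℚ.< ε →
  ∃[ N ] (∀ n → N ℕ.≤ n → seq x n ℚ.< seq y n ℚ.+ ε)

fromℚ : ℚ → ℝ
fromℚ q = mkℝ (λ _ → q) λ ε 0<ε →
  0 , λ _ _ _ _ → subst (ℚ._< ε) (cong ∣_∣ (sym (ℚ.+-inverseʳ q))) 0<ε

fromℕ : ℕ → ℝ
fromℕ n = fromℚ (ℤ.+ n ℚ./ 1)

0ℝ 1ℝ : ℝ
0ℝ = fromℚ 0ℚ
1ℝ = fromℚ 1ℚ

abstract
  halve : ∀ ε → 0ℚ ℚ.< ε → ∃[ δ ] (0ℚ ℚ.< δ × δ ℚ.+ δ ≡ ε)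
  halve ε 0<ε = ½ ℚ.* ε , ℚ.*-monoʳ-<-pos ½ 0<ε ,
    trans (sym (ℚ.*-distribʳ-+ ε ½ ½)) (ℚ.*-identityˡ ε)

  divide : ∀ B ε → 0ℚ ℚ.< B → 0ℚ ℚ.< ε → ∃[ δ ] (0ℚ ℚ.< δ × B ℚ.* δ ≡ ε)
  divide B ε 0<B 0<ε = 1/B ℚ.* ε , 0<δ , B*δ≡ε
    where
    instance
      B-pos : ℚ.Positive B
      B-pos = ℚ.positive 0<B
      B-nonZero : ℚ.NonZero B
      B-nonZero = ℚ.pos⇒nonZero B
    1/B : ℚ
    1/B = ℚ.1/ B
    instance
      1/B-pos : ℚ.Positive 1/B
      1/B-pos = ℚ.1/pos⇒pos B
    0<δ : 0ℚ ℚ.< 1/B ℚ.* ε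
    0<δ = subst (ℚ._< 1/B ℚ.* ε) (ℚ.*-zeroʳ 1/B) (ℚ.*-monoʳ-<-pos 1/B 0<ε)
    B*δ≡ε : B ℚ.* (1/B ℚ.* ε) ≡ ε
    B*δ≡ε = trans (sym (ℚ.*-assoc B 1/B ε))
      (trans (cong (ℚ._* ε) (ℚ.*-inverseʳ B)) (ℚ.*-identityˡ ε))

  bounded : ∀ {s} → Cauchy s →
    ∃[ B ] (0ℚ ℚ.< B × ∃[ N ] (∀ n → N ℕ.≤ n → ∣ s n ∣ ℚ.< B))
  bounded {s} c with c 1ℚ (ℚ.positive⁻¹ 1ℚ)
  ... | N , close = 1ℚ ℚ.+ ∣ s N ∣ , 0<B , N , bound
    where
    open ℚ.≤-Reasoning
    0<B : 0ℚ ℚ.< 1ℚ ℚ.+ ∣ s N ∣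
    0<B = ℚ.+-mono-<-≤ (ℚ.positive⁻¹ 1ℚ) (ℚ.0≤∣p∣ (s N))
    split : ∀ a b → a ≡ (a ℚ.- b) ℚ.+ b
    split = solve 2 (λ a b → a := (a :- b) :+ b) refl
      where open +-*-Solver
    bound : ∀ n → N ℕ.≤ n → ∣ s n ∣ ℚ.< 1ℚ ℚ.+ ∣ s N ∣
    bound n N≤n = begin-strict
      ∣ s n ∣                      ≡⟨ cong ∣_∣ (split (s n) (s N)) ⟩
      ∣ (s n ℚ.- s N) ℚ.+ s N ∣    ≤⟨ ℚ.∣p+q∣≤∣p∣+∣q∣ (s n ℚ.- s N) (s N) ⟩
      ∣ s n ℚ.- s N ∣ ℚ.+ ∣ s N ∣  <⟨ ℚ.+-monoˡ-< ∣ s N ∣ (close n N N≤n ℕ.≤-refl) ⟩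
      1ℚ ℚ.+ ∣ s N ∣               ∎

  +-close : ∀ a b c d {α β} → ∣ a ℚ.- c ∣ ℚ.< α → ∣ b ℚ.- d ∣ ℚ.< β →
    ∣ (a ℚ.+ b) ℚ.- (c ℚ.+ d) ∣ ℚ.< α ℚ.+ β
  +-close a b c d {α} {β} a~c b~d = begin-strict
    ∣ (a ℚ.+ b) ℚ.- (c ℚ.+ d) ∣      ≡⟨ cong ∣_∣ (+-diff a b c d) ⟩
    ∣ (a ℚ.- c) ℚ.+ (b ℚ.- d) ∣      ≤⟨ ℚ.∣p+q∣≤∣p∣+∣q∣ (a ℚ.- c) (b ℚ.- d) ⟩
    ∣ a ℚ.- c ∣ ℚ.+ ∣ b ℚ.- d ∣      <⟨ ℚ.+-mono-< a~c b~d ⟩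
    α ℚ.+ β                          ∎
    where
    open ℚ.≤-Reasoning
    +-diff : ∀ a b c d → (a ℚ.+ b) ℚ.- (c ℚ.+ d) ≡ (a ℚ.- c) ℚ.+ (b ℚ.- d)
    +-diff = solve 4 (λ a b c d → (a :+ b) :- (c :+ d) := (a :- c) :+ (b :- d)) refl
      where open +-*-Solver

  *-bound : ∀ a b {B δ} → 0ℚ ℚ.< B → ∣ a ∣ ℚ.< B → ∣ b ∣ ℚ.< δ → ∣ a ℚ.* b ∣ ℚ.< B ℚ.* δ
  *-bound a b {B} {δ} 0<B a<B b<δ = begin-strict
    ∣ a ℚ.* b ∣      ≡⟨ ℚ.∣p*q∣≡∣p∣*∣q∣ a b ⟩
    ∣ a ∣ ℚ.* ∣ b ∣  ≤⟨ ℚ.*-monoʳ-≤-nonNeg ∣ b ∣ {{ℚ.nonNegative (ℚ.0≤∣p∣ b)}} (ℚ.<⇒≤ a<B) ⟩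
    B ℚ.* ∣ b ∣      <⟨ ℚ.*-monoʳ-<-pos B {{ℚ.positive 0<B}} b<δ ⟩
    B ℚ.* δ          ∎
    where open ℚ.≤-Reasoning

  *-close : ∀ a b c d {A B δ} → 0ℚ ℚ.< A → 0ℚ ℚ.< B → ∣ a ∣ ℚ.< A → ∣ d ∣ ℚ.< B →
    ∣ a ℚ.- c ∣ ℚ.< δ → ∣ b ℚ.- d ∣ ℚ.< δ →
    ∣ (a ℚ.* b) ℚ.- (c ℚ.* d) ∣ ℚ.< (A ℚ.+ B) ℚ.* δ
  *-close a b c d {A} {B} {δ} 0<A 0<B a<A d<B a~c b~d = begin-strict
    ∣ (a ℚ.* b) ℚ.- (c ℚ.* d) ∣
      ≡⟨ cong ∣_∣ (*-diff a b c d) ⟩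
    ∣ a ℚ.* (b ℚ.- d) ℚ.+ d ℚ.* (a ℚ.- c) ∣
      ≤⟨ ℚ.∣p+q∣≤∣p∣+∣q∣ (a ℚ.* (b ℚ.- d)) (d ℚ.* (a ℚ.- c)) ⟩
    ∣ a ℚ.* (b ℚ.- d) ∣ ℚ.+ ∣ d ℚ.* (a ℚ.- c) ∣
      <⟨ ℚ.+-mono-< (*-bound a (b ℚ.- d) 0<A a<A b~d) (*-bound d (a ℚ.- c) 0<B d<B a~c) ⟩
    A ℚ.* δ ℚ.+ B ℚ.* δ
      ≡⟨ sym (ℚ.*-distribʳ-+ δ A B) ⟩
    (A ℚ.+ B) ℚ.* δ ∎
    where
    open ℚ.≤-Reasoning
    *-diff : ∀ a b c d →
      (a ℚ.* b) ℚ.- (c ℚ.* d) ≡ a ℚ.* (b ℚ.- d) ℚ.+ d ℚ.* (a ℚ.- c)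
    *-diff = solve 4 (λ a b c d →
      (a :* b) :- (c :* d) := a :* (b :- d) :+ d :* (a :- c)) refl
      where open +-*-Solver

-- Opaque: _≈_, _<_ and _≤_ depend on the underlying sequences only.
abstract
  +-cauchy : ∀ {s t} → Cauchy s → Cauchy t → Cauchy (λ n → s n ℚ.+ t n)
  +-cauchy {s} {t} cs ct ε 0<ε =
    let δ , 0<δ , δ+δ≡ε = halve ε 0<ε
        M , closeₛ = cs δ 0<δ
        N , closeₜ = ct δ 0<δ
    in M ⊔ N , λ m n ≤m ≤n →
      subst (∣ (s m ℚ.+ t m) ℚ.- (s n ℚ.+ t n) ∣ ℚ.<_) δ+δ≡ε
        (+-close (s m) (t m) (s n) (t n)
          (closeₛ m n (ℕ.m⊔n≤o⇒m≤o M N ≤m) (ℕ.m⊔n≤o⇒m≤o M N ≤n))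
          (closeₜ m n (ℕ.m⊔n≤o⇒n≤o M N ≤m) (ℕ.m⊔n≤o⇒n≤o M N ≤n)))

  *-cauchy : ∀ {s t} → Cauchy s → Cauchy t → Cauchy (λ n → s n ℚ.* t n)
  *-cauchy {s} {t} cs ct ε 0<ε =
    let A , 0<A , K , s<A = bounded cs
        B , 0<B , L , t<B = bounded ct
        δ , 0<δ , δ≡ = divide (A ℚ.+ B) ε (ℚ.+-mono-< 0<A 0<B) 0<ε
        M , closeₛ = cs δ 0<δ
        N , closeₜ = ct δ 0<δ
        KL≤ : ∀ {k} → (K ⊔ L) ⊔ (M ⊔ N) ℕ.≤ k → K ⊔ L ℕ.≤ k
        KL≤ = ℕ.m⊔n≤o⇒m≤o (K ⊔ L) (M ⊔ N)
        MN≤ : ∀ {k} → (K ⊔ L) ⊔ (M ⊔ N) ℕ.≤ k → M ⊔ N ℕ.≤ k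
        MN≤ = ℕ.m⊔n≤o⇒n≤o (K ⊔ L) (M ⊔ N)
    in (K ⊔ L) ⊔ (M ⊔ N) , λ m n ≤m ≤n →
      subst (∣ (s m ℚ.* t m) ℚ.- (s n ℚ.* t n) ∣ ℚ.<_) δ≡
        (*-close (s m) (t m) (s n) (t n) 0<A 0<B
          (s<A m (ℕ.m⊔n≤o⇒m≤o K L (KL≤ ≤m)))
          (t<B n (ℕ.m⊔n≤o⇒n≤o K L (KL≤ ≤n)))
          (closeₛ m n (ℕ.m⊔n≤o⇒m≤o M N (MN≤ ≤m)) (ℕ.m⊔n≤o⇒m≤o M N (MN≤ ≤n)))
          (closeₜ m n (ℕ.m⊔n≤o⇒n≤o M N (MN≤ ≤m)) (ℕ.m⊔n≤o⇒n≤o M N (MN≤ ≤n))))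

infixl 6 _+_
infixl 7 _*_

_+_ : ℝ → ℝ → ℝ
x + y = mkℝ (λ n → seq x n ℚ.+ seq y n) (+-cauchy {seq x} {seq y} (cauchy x) (cauchy y))

_*_ : ℝ → ℝ → ℝ
x * y = mkℝ (λ n → seq x n ℚ.* seq y n) (*-cauchy {seq x} {seq y} (cauchy x) (cauchy y))

ℝ-rawSemiring : RawSemiring 0ℓ 0ℓ
ℝ-rawSemiring = record
  { Carrier = ℝ ; _≈_ = _≈_ ; _+_ = _+_ ; _*_ = _*_ ; 0# = 0ℝ ; 1# = 1ℝ }

open RawSemiringDefinitions ℝ-rawSemiring public using (sum; _^_)

Point : ℕ → Set
Point d = Vector ℝ d

infix 4 _≈ᵖ_

_≈ᵖ_ : ∀ {d} → Point d → Point d → Set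
p ≈ᵖ q = ∀ i → p i ≈ q i

PointSet : ℕ → Set₁
PointSet d = Pred (Point d) 0ℓ

⟨_,_⟩ : ∀ {d} → Point d → Point d → ℝ
⟨ a , p ⟩ = sum (zipWith _*_ a p)

singleton : ∀ {d} → Point d → PointSet d
singleton p q = q ≈ᵖ p

range : ∀ {d n} → (Fin n → Point d) → PointSet d
range f p = ∃[ i ] p ≈ᵖ f i

-- X is a finite set with exactly n points; in particular it is closed
-- under the equality of points.
HasCardinality : ∀ {d} → PointSet d → ℕ → Set
HasCardinality {d} X n =
  ∃[ f ] (Injective {A = Fin n} {B = Point d} _≡_ _≈ᵖ_ f × X ≐ range f)

combination : ∀ {d m} → (Fin m → ℝ) → (Fin m → Point d) → Point d
combination w p j = sum (λ i → w i * p i j)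

aff : ∀ {d} → PointSet d → PointSet d
aff X q = ∃[ m ] ∃[ w ] ∃[ p ] ((∀ (i : Fin m) → p i ∈ X) ×
  sum w ≈ 1ℝ × q ≈ᵖ combination w p)

conv : ∀ {d} → PointSet d → PointSet d
conv X q = ∃[ m ] ∃[ w ] ∃[ p ] ((∀ (i : Fin m) → p i ∈ X) ×
  (∀ i → 0ℝ ≤ w i) × sum w ≈ 1ℝ × q ≈ᵖ combination w p)

AffinelySpanning : ∀ {d} → PointSet d → Set
AffinelySpanning X = ∀ q → q ∈ aff X

record Hyperplane (d : ℕ) : Set where
  field
    normal   : Point d
    offset   : ℝ
    nonzero  : ∃[ i ] (normal i < 0ℝ ⊎ 0ℝ < normal i)

  points : PointSet d
  points p = ⟨ normal , p ⟩ ≈ offset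

  lowerHalfSpace upperHalfSpace : PointSet d
  lowerHalfSpace p = ⟨ normal , p ⟩ ≤ offset
  upperHalfSpace p = offset ≤ ⟨ normal , p ⟩

open Hyperplane public

_SupportingHyperplaneOf_ : ∀ {d} → Hyperplane d → PointSet d → Set
H SupportingHyperplaneOf P =
  (∃[ p ] p ∈ P ∩ points H) × (P ⊆ lowerHalfSpace H ⊎ P ⊆ upperHalfSpace H)

-- Normals are nonzero, so the factor is automatically nonzero and the
-- relation is symmetric.
Parallel : ∀ {d} → Hyperplane d → Hyperplane d → Set
Parallel H K = ∃[ c ] (∀ i → normal K i ≈ c * normal H i)

Different : ∀ {d} → Hyperplane d → Hyperplane d → Set
Different H K = ¬ (points H ≐ points K)

StrictlyAntipodalPair : ∀ {d} → PointSet d → Point d → Point d → Set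
StrictlyAntipodalPair {d} X x y = ∃[ H′ ] ∃[ H″ ]
  ( Different {d} H′ H″ × Parallel H′ H″
  × H′ SupportingHyperplaneOf conv X × H″ SupportingHyperplaneOf conv X
  × (X ∩ points H′) ≐ singleton x × (X ∩ points H″) ≐ singleton y )

StrictlyAntipodal : ∀ {d} → PointSet d → Set
StrictlyAntipodal X =
  ∀ x y → x ∈ X → y ∈ X → ¬ (x ≈ᵖ y) → StrictlyAntipodalPair X x y

{-# OPTIONS --safe #-}

-- For d ≥ 4^⌊d/3⌋ the vertices of a simplex do.  Otherwise index the
-- points by words w of length k = ⌊d/3⌋ over four letters, and give each
-- letter position a block of three coordinates, in which the four letters
-- sit at the vertices of a tetrahedron.  Let every tetrahedron rotate
-- about an axis while its vertices are pulled towards the centre: at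
-- time t the vertex T moves to T + ε (t J T − t² T), for a small ε > 0.
-- Evaluate all blocks of the word w at the same time t(w), an injective
-- function of w that is a sum of functions of the single letters.  If u
-- and v differ in a block, by letters p and q say, take a functional on
-- this block that is minimal at p and maximal at q.  To first order in ε
-- it is a convex quadratic function of t on the words with letter p and a
-- concave one on those with letter q.  Subtracting a multiple of t, which
-- is linear in the coordinates up to O(ε), and tilting the functional
-- moves the two vertices of these parabolas to t(u) and t(v), so that for
-- small ε the minimum is attained at u only and the maximum at v only.
--
-- Strict antipodality depends only on the space of functions spanned by
-- the coordinates.  Replacing these by functions that are affine
-- coordinates at some of the points, and adding further functions while
-- there are too few, makes the set affinely spanning.
module Submission where

open import Algebra.Bundles using (CommutativeRing)
import Data.Integer.Base as ℤ
open import Data.Fin.Base as Fin using (Fin; zero; suc; toℕ; combine; remQuot; finToFun; funToFin)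
open import Data.Fin.Patterns using (0F; 1F; 2F; 3F)
import Data.Fin.Properties as Fin
import Data.Integer.Properties as ℤ
import Data.Nat.Base as ℕ
open ℕ using (ℕ; zero; suc; z≤n; s≤s; _⊔_)
open import Data.Nat.Divisibility using (∣-refl)
open import Data.Nat.DivMod using (_/_; +-distrib-/-∣ˡ; m/n*n≤m)
import Data.Nat.Properties as ℕ
open import Data.Product.Base using (_×_; _,_; ∃-syntax; proj₁; proj₂)
import Data.Rational.Base as ℚ
open ℚ using (ℚ; 0ℚ; 1ℚ; ½; ∣_∣)
import Data.Rational.Properties as ℚ
open import Data.Rational.Solver using (module +-*-Solver)
import Data.Rational.Unnormalised.Base as ℚᵘ
import Data.Rational.Unnormalised.Properties as ℚᵘ
open import Data.Sum.Base using (_⊎_; inj₁; inj₂)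
open import Function.Base using (_∘_; id)
open import Relation.Binary.Definitions using (tri<; tri≈; tri>)
open import Relation.Binary.PropositionalEquality
  using (_≡_; _≢_; _≗_; refl; sym; trans; cong; cong₂; subst; subst₂; module ≡-Reasoning)
open import Relation.Nullary.Decidable
  using (Dec; yes; no; ¬?; decidable-stable; from-yes; _→-dec_; _×-dec_)
open import Relation.Nullary.Negation using (¬_; contradiction)
open import Relation.Unary using (_∈_; _∩_; _≐_)

open import Algebra.Properties.Semiring.Mult (CommutativeRing.semiring ℚ.+-*-commutativeRing)
  using (×-homo-+) renaming (_×_ to _·_)
open import Algebra.Properties.Semiring.Sum (CommutativeRing.semiring ℚ.+-*-commutativeRing)
  using (sum-cong-≗; sum-replicate-zero; ∑-distrib-+; *-distribˡ-sum; *-distribʳ-sum; ∑-comm)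
  renaming (sum to ∑)

-- Affine spans of functions on a finite set, and affine coordinates.

module Interpolation where
  open import Data.Rational.Base using (_+_; _*_; _-_; -_; 1/_)
  open +-*-Solver using (solve; _:=_; _:+_; _:*_; _:-_; con)

  δ : ∀ {n} → Fin n → Fin n → ℚ
  δ zero    zero    = 1ℚ
  δ zero    (suc j) = 0ℚ
  δ (suc i) zero    = 0ℚ
  δ (suc i) (suc j) = δ i j

  δ-diag : ∀ {n} (i : Fin n) → δ i i ≡ 1ℚ
  δ-diag zero    = refl
  δ-diag (suc i) = δ-diag i

  δ-off : ∀ {n} {i j : Fin n} → i ≢ j → δ i j ≡ 0ℚ
  δ-off {i = zero}  {zero}  i≢j = contradiction refl i≢j
  δ-off {i = zero}  {suc j} i≢j = refl
  δ-off {i = suc i} {zero}  i≢j = refl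
  δ-off {i = suc i} {suc j} i≢j = δ-off (i≢j ∘ cong suc)

  δ-comm : ∀ {n} (i j : Fin n) → δ i j ≡ δ j i
  δ-comm zero    zero    = refl
  δ-comm zero    (suc j) = refl
  δ-comm (suc i) zero    = refl
  δ-comm (suc i) (suc j) = δ-comm i j

  ∑-zero : ∀ {n} {x : Fin n → ℚ} → (∀ i → x i ≡ 0ℚ) → ∑ x ≡ 0ℚ
  ∑-zero {n} x≡0 = trans (sum-cong-≗ x≡0) (sum-replicate-zero n)

  ∑-δ : ∀ {n} (x : Fin n → ℚ) i → ∑ (λ j → x j * δ j i) ≡ x i
  ∑-δ x zero    = trans (cong₂ _+_ (ℚ.*-identityʳ (x zero)) (∑-zero (ℚ.*-zeroʳ ∘ x ∘ suc)))
    (ℚ.+-identityʳ (x zero))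
  ∑-δ x (suc i) = trans (cong₂ _+_ (ℚ.*-zeroʳ (x zero)) (∑-δ (x ∘ suc) i))
    (ℚ.+-identityˡ (x (suc i)))

  private variable
    M e e′ : ℕ

  Fn : ℕ → Set
  Fn N = Fin N → ℚ

  infixl 6 _⊕_
  infixr 7 _⊙_

  -- Constants are included because adding one does not move the places of extremes. Functions are
  -- compared only pointwise, hence `resp`.
  data Span {N e} (G : Fin e → Fn N) : Fn N → Set where
    gen   : ∀ j → Span G (G j)
    const : ∀ c → Span G (λ _ → c)
    _⊕_   : ∀ {g h} → Span G g → Span G h → Span G (λ w → g w + h w)
    _⊙_   : ∀ {h} c → Span G h → Span G (λ w → c * h w)
    resp  : ∀ {g h} → g ≗ h → Span G g → Span G h

  Span-bind : ∀ {N} {G : Fin e → Fn N} {G′ : Fin e′ → Fn N} →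
    (∀ j → Span G′ (G j)) → ∀ {h} → Span G h → Span G′ h
  Span-bind G⊆ (gen j)      = G⊆ j
  Span-bind G⊆ (const c)    = const c
  Span-bind G⊆ (x ⊕ y)      = Span-bind G⊆ x ⊕ Span-bind G⊆ y
  Span-bind G⊆ (c ⊙ x)      = c ⊙ Span-bind G⊆ x
  Span-bind G⊆ (resp g≗h x) = resp g≗h (Span-bind G⊆ x)

  Span-∑ : ∀ {N m} {G : Fin e → Fn N} (h : Fin m → Fn N) →
    (∀ j → Span G (h j)) → Span G (λ w → ∑ (λ j → h j w))
  Span-∑ {m = zero}  h h∈ = const 0ℚ
  Span-∑ {m = suc m} h h∈ = h∈ zero ⊕ Span-∑ (h ∘ suc) (h∈ ∘ suc)

  -- Reads off from a derivation the coefficient vector that later becomes the normal of the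
  -- hyperplanes.
  affineForm : ∀ {N} {G : Fin e → Fn N} {h} → Span G h →
    ∃[ c ] ∃[ a ] (∀ w → h w ≡ c + ∑ (λ j → a j * G j w))
  affineForm {G = G} (gen j) = 0ℚ , (λ k → δ k j) , λ w → sym (begin
    0ℚ + ∑ (λ k → δ k j * G k w)  ≡⟨ ℚ.+-identityˡ _ ⟩
    ∑ (λ k → δ k j * G k w)       ≡⟨ sum-cong-≗ (λ k → ℚ.*-comm (δ k j) (G k w)) ⟩
    ∑ (λ k → G k w * δ k j)       ≡⟨ ∑-δ (λ k → G k w) j ⟩
    G j w                         ∎)
    where open ≡-Reasoning
  affineForm {G = G} (const c) = c , (λ _ → 0ℚ) , λ w → sym
    (trans (cong (c +_) (∑-zero (λ j → ℚ.*-zeroˡ (G j w)))) (ℚ.+-identityʳ c))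
  affineForm {G = G} (_⊕_ {g} {h} x y) with affineForm x | affineForm y
  ... | c , a , g≡ | d , b , h≡ = c + d , (λ j → a j + b j) , λ w → begin
    g w + h w
      ≡⟨ cong₂ _+_ (g≡ w) (h≡ w) ⟩
    (c + ∑ (λ j → a j * G j w)) + (d + ∑ (λ j → b j * G j w))
      ≡⟨ solve 4 (λ c x d y → (c :+ x) :+ (d :+ y) := (c :+ d) :+ (x :+ y)) refl
           c _ d _ ⟩
    (c + d) + (∑ (λ j → a j * G j w) + ∑ (λ j → b j * G j w))
      ≡⟨ cong (c + d +_) (∑-distrib-+ (λ j → a j * G j w) (λ j → b j * G j w)) ⟨
    (c + d) + ∑ (λ j → a j * G j w + b j * G j w)
      ≡⟨ cong (c + d +_) (sum-cong-≗ (λ j → ℚ.*-distribʳ-+ (G j w) (a j) (b j))) ⟨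
    (c + d) + ∑ (λ j → (a j + b j) * G j w) ∎
    where open ≡-Reasoning
  affineForm {G = G} (_⊙_ {h} k x) with affineForm x
  ... | c , a , h≡ = k * c , (λ j → k * a j) , λ w → begin
    k * h w                                  ≡⟨ cong (k *_) (h≡ w) ⟩
    k * (c + ∑ (λ j → a j * G j w))          ≡⟨ ℚ.*-distribˡ-+ k c _ ⟩
    k * c + k * ∑ (λ j → a j * G j w)        ≡⟨ cong (k * c +_) (*-distribˡ-sum k (λ j → a j * G j w)) ⟩
    k * c + ∑ (λ j → k * (a j * G j w))      ≡⟨ cong (k * c +_) (sum-cong-≗ (λ j → ℚ.*-assoc k (a j) (G j w))) ⟨
    k * c + ∑ (λ j → k * a j * G j w)        ∎
    where open ≡-Reasoning
  affineForm (resp g≗h x) with affineForm x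
  ... | c , a , g≡ = c , a , λ w → trans (sym (g≗h w)) (g≡ w)

  -- Functions on suc M points that are affine coordinates with respect to
  -- the points zero, node zero, node (suc zero), …
  record Frame (M e : ℕ) : Set where
    field
      coord      : Fin e → Fn (suc M)
      node       : Fin e → Fin (suc M)
      coord-zero : ∀ j → coord j zero ≡ 0ℚ
      coord-node : ∀ j i → coord j (node i) ≡ δ j i

  open Frame public

  emptyFrame : Frame M 0
  emptyFrame = record { coord = λ () ; node = λ () ; coord-zero = λ () ; coord-node = λ () }

  -- One elimination step. Rescaled to 1 at `u`, `h` becomes the new coordinate, and subtracting
  -- multiples of it makes the old ones vanish at `u`. Their values at `zero` and at the old nodes
  -- survive because `h` vanishes there.
  extend : (S : Frame M e) (h : Fn (suc M)) → h zero ≡ 0ℚ → (∀ i → h (node S i) ≡ 0ℚ) →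
    ∀ u → h u ≢ 0ℚ → ∃[ S′ ]
      ((∀ j → Span (coord {M} {suc e} S′) (coord S j)) × Span (coord S′) h)
  extend {M} {e} S h h-zero h-node u hu≢0 = S′ , old , new
    where
    instance
      hu-nonZero : ℚ.NonZero (h u)
      hu-nonZero = ℚ.≢-nonZero hu≢0
    k : Fn (suc M)
    k w = 1/ h u * h w
    k-vanishes : ∀ {w} → h w ≡ 0ℚ → k w ≡ 0ℚ
    k-vanishes hw≡0 = trans (cong (1/ h u *_) hw≡0) (ℚ.*-zeroʳ (1/ h u))
    k-u : k u ≡ 1ℚ
    k-u = ℚ.*-inverseˡ (h u)
    minus-zero : ∀ g c {x} → x ≡ 0ℚ → g - c * x ≡ g
    minus-zero g c refl = solve 2 (λ g c → g :- c :* con 0ℚ := g) refl g c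
    minus-self : ∀ g {x} → x ≡ 1ℚ → g - g * x ≡ 0ℚ
    minus-self g refl = solve 1 (λ g → g :- g :* con 1ℚ := con 0ℚ) refl g
    S′ : Frame M (suc e)
    coord S′ zero    = k
    coord S′ (suc j) = λ w → coord S j w - coord S j u * k w
    node S′ zero    = u
    node S′ (suc i) = node S i
    coord-zero S′ zero    = k-vanishes h-zero
    coord-zero S′ (suc j) = trans (minus-zero _ (coord S j u) (k-vanishes h-zero)) (coord-zero S j)
    coord-node S′ zero    zero    = k-u
    coord-node S′ zero    (suc i) = k-vanishes (h-node i)
    coord-node S′ (suc j) zero    = minus-self (coord S j u) k-u
    coord-node S′ (suc j) (suc i) =
      trans (minus-zero _ (coord S j u) (k-vanishes (h-node i))) (coord-node S j i)
    old : ∀ j → Span (coord S′) (coord S j)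
    old j = resp (λ w → solve 3 (λ g a k → (g :- a :* k) :+ a :* k := g) refl
                          (coord S j w) (coord S j u) (k w))
      (gen (suc j) ⊕ coord S j u ⊙ gen zero)
    new : Span (coord S′) h
    new = resp (λ w → trans (sym (ℚ.*-assoc (h u) (1/ h u) (h w)))
                 (trans (cong (_* h w) (ℚ.*-inverseʳ (h u))) (ℚ.*-identityˡ (h w))))
      (h u ⊙ gen zero)

  -- Lagrange interpolation from the values at `zero` and at the nodes.
  interpolant : Frame M e → Fn (suc M) → Fn (suc M)
  interpolant S h w = h zero + ∑ (λ j → (h (node S j) - h zero) * coord S j w)

  interpolant∈Span : (S : Frame M e) (h : Fn (suc M)) → Span (coord S) (interpolant S h)
  interpolant∈Span S h =
    const (h zero) ⊕ Span-∑ _ (λ j → (h (node S j) - h zero) ⊙ gen j)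

  interpolant-zero : (S : Frame M e) (h : Fn (suc M)) → interpolant S h zero ≡ h zero
  interpolant-zero S h = trans
    (cong (h zero +_) (∑-zero (λ j →
      trans (cong ((h (node S j) - h zero) *_) (coord-zero S j)) (ℚ.*-zeroʳ (h (node S j) - h zero)))))
    (ℚ.+-identityʳ (h zero))

  interpolant-node : (S : Frame M e) (h : Fn (suc M)) →
    ∀ i → interpolant S h (node S i) ≡ h (node S i)
  interpolant-node S h i = begin
    h zero + ∑ (λ j → c j * coord S j (node S i))
      ≡⟨ cong (h zero +_) (sum-cong-≗ (λ j → cong (c j *_) (coord-node S j i))) ⟩
    h zero + ∑ (λ j → c j * δ j i)
      ≡⟨ cong (h zero +_) (∑-δ c i) ⟩
    h zero + c i
      ≡⟨ solve 2 (λ a b → a :+ (b :- a) := b) refl (h zero) (h (node S i)) ⟩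
    h (node S i) ∎
    where
    open ≡-Reasoning
    c : _
    c j = h (node S j) - h zero

  -- Gaussian elimination: each function is reduced by its interpolant. A zero residue means that it
  -- is spanned already; otherwise a point where the residue is nonzero becomes a new node.
  frameFor : ∀ {m} (F : Fin m → Fn (suc M)) →
    ∃[ e ] (e ℕ.≤ m × ∃[ S ] (∀ j → Span (coord {M} {e} S) (F j)))
  frameFor {M} {zero}  F = 0 , z≤n , emptyFrame , λ ()
  frameFor {M} {suc m} F with frameFor {M} {m} (F ∘ suc)
  ... | e , e≤m , S , F∈S = step
    where
    h : Fn (suc M)
    h = F zero
    residue : Fn (suc M)
    residue w = h w - interpolant S h w
    residue-vanishes : ∀ {w} → interpolant S h w ≡ h w → residue w ≡ 0ℚ
    residue-vanishes {w} eq = trans (cong (λ x → h w - x) eq) (ℚ.+-inverseʳ (h w))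
    h≡ : ∀ w → residue w + interpolant S h w ≡ h w
    h≡ w = solve 2 (λ x y → (x :- y) :+ y := x) refl (h w) (interpolant S h w)
    step : ∃[ e′ ] (e′ ℕ.≤ suc m × ∃[ S′ ] (∀ j → Span (coord {M} {e′} S′) (F j)))
    step with Fin.any? (λ w → ¬? (residue w ℚ.≟ 0ℚ))
    ... | no ¬∃ = e , ℕ.m≤n⇒m≤1+n e≤m , S , λ where
      zero    → resp (λ w → trans (sym (ℚ.+-identityˡ _)) (trans
          (cong (_+ interpolant S h w)
            (sym (decidable-stable (residue w ℚ.≟ 0ℚ) (λ ≢0 → ¬∃ (w , ≢0)))))
          (h≡ w)))
        (interpolant∈Span S h)
      (suc j) → F∈S j
    ... | yes (u , residue≢0) =
      let S′ , old , new = extend S residue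
            (residue-vanishes (interpolant-zero S h))
            (λ i → residue-vanishes (interpolant-node S h i)) u residue≢0
      in suc e , s≤s e≤m , S′ , λ where
        zero    → resp h≡ (new ⊕ Span-bind old (interpolant∈Span S h))
        (suc j) → Span-bind old (F∈S j)

  -- Pigeonhole: `zero` and the `e` nodes cannot exhaust more than `e + 1` points.
  unusedPoint : e ℕ.< M → (S : Frame M e) →
    ∃[ u ] (u ≢ zero × (∀ i → u ≢ node S i))
  unusedPoint {e} {M} e<M S =
    let u , ¬hit = Fin.¬∀⟶∃¬ (suc M) Hit hit? ¬allHit
    in u , (λ u≡ → ¬hit (zero , sym u≡)) , λ i u≡ → ¬hit (suc i , sym u≡)
    where
    base : Fin (suc e) → Fin (suc M)
    base zero    = zero
    base (suc i) = node S i
    Hit : Fin (suc M) → Set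
    Hit u = ∃[ i ] base i ≡ u
    hit? = λ u → Fin.any? (λ i → base i Fin.≟ u)
    ¬allHit : ¬ (∀ u → Hit u)
    ¬allHit hit = ℕ.<⇒≱ (s≤s e<M) (Fin.injective⇒≤ {f = proj₁ ∘ hit} λ {u} {v} eq →
      trans (sym (proj₂ (hit u))) (trans (cong base eq) (proj₂ (hit v))))

  -- The indicator of a point outside the frame vanishes at all frame points, so `extend` can add
  -- it.
  pad : ∀ {d} → e ℕ.≤′ d → d ℕ.≤ M → (S : Frame M e) →
    ∃[ S′ ] (∀ j → Span (coord {M} {d} S′) (coord S j))
  pad ℕ.≤′-refl       d≤M S = S , gen
  pad (ℕ.≤′-step e≤d) d<M S =
    let S₁ , S⊆ = pad e≤d (ℕ.<⇒≤ d<M) S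
        u , u≢zero , u≢node = unusedPoint d<M S₁
        S₂ , S₁⊆ , _ = extend S₁ (δ u) (δ-off u≢zero) (δ-off ∘ u≢node) u
          (λ eq → contradiction (trans (sym (δ-diag u)) eq) λ ())
    in S₂ , λ j → Span-bind S₁⊆ (S⊆ j)

  frameOfSize : ∀ {m d} → m ℕ.≤ d → d ℕ.≤ M → (F : Fin m → Fn (suc M)) →
    ∃[ S ] (∀ j → Span (coord {M} {d} S) (F j))
  frameOfSize m≤d d≤M F =
    let e , e≤m , S , F∈ = frameFor F
        S′ , S⊆ = pad (ℕ.≤⇒≤′ (ℕ.≤-trans e≤m m≤d)) d≤M S
    in S′ , λ j → Span-bind S⊆ (F∈ j)

open Interpolation

-- The level sets of `h` through `u` and `v` will be the two supporting hyperplanes.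
record Separates {N} (h : Fn N) (u v : Fin N) : Set where
  field
    minimal : ∀ w → w ≢ u → h u ℚ.< h w
    maximal : ∀ w → w ≢ v → h w ℚ.< h v

open Separates

Separating : ∀ {N m} → (Fin m → Fn N) → Set
Separating F = ∀ u v → u ≢ v → ∃[ h ] (Span F h × Separates h u v)

-- Statements that hold for all sufficiently small positive ε.

module Eventuality where
  open import Defs using (divide)
  open import Data.Rational.Base using (_+_; _*_; _-_; -_; _<_; _≤_)
  open +-*-Solver using (solve; _:=_; _:+_; _:*_; _:-_; con)

  Eventually : (ℚ → Set) → Set
  Eventually P = ∃[ ε₀ ] (0ℚ < ε₀ × (∀ ε → 0ℚ < ε → ε ≤ ε₀ → P ε))

  private variable
    P Q : ℚ → Set

  0<1 : 0ℚ < 1ℚ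
  0<1 = ℚ.positive⁻¹ 1ℚ

  always : (∀ ε → 0ℚ < ε → P ε) → Eventually P
  always p = 1ℚ , 0<1 , λ ε 0<ε _ → p ε 0<ε

  eventually-zip : ∀ {R : ℚ → Set} → (∀ ε → 0ℚ < ε → P ε → Q ε → R ε) →
    Eventually P → Eventually Q → Eventually R
  eventually-zip f (ε₁ , 0<ε₁ , p) (ε₂ , 0<ε₂ , q) with ℚ.≤-total ε₁ ε₂
  ... | inj₁ ε₁≤ε₂ = ε₁ , 0<ε₁ , λ ε 0<ε ε≤ →
    f ε 0<ε (p ε 0<ε ε≤) (q ε 0<ε (ℚ.≤-trans ε≤ ε₁≤ε₂))
  ... | inj₂ ε₂≤ε₁ = ε₂ , 0<ε₂ , λ ε 0<ε ε≤ →
    f ε 0<ε (p ε 0<ε (ℚ.≤-trans ε≤ ε₂≤ε₁)) (q ε 0<ε ε≤)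

  eventually-map : (∀ ε → 0ℚ < ε → P ε → Q ε) → Eventually P → Eventually Q
  eventually-map f (ε₀ , 0<ε₀ , p) = ε₀ , 0<ε₀ , λ ε 0<ε ε≤ → f ε 0<ε (p ε 0<ε ε≤)

  eventually-∀ : ∀ {n} {P : Fin n → ℚ → Set} →
    (∀ i → Eventually (P i)) → Eventually (λ ε → ∀ i → P i ε)
  eventually-∀ {zero}  p = always λ _ _ ()
  eventually-∀ {suc n} p = eventually-zip
    (λ { _ _ p₀ pₛ zero → p₀ ; _ _ p₀ pₛ (suc i) → pₛ i })
    (p zero) (eventually-∀ (p ∘ suc))

  p<1+p : ∀ p → p < 1ℚ + p
  p<1+p p = subst (_< 1ℚ + p) (ℚ.+-identityˡ p) (ℚ.+-monoˡ-< p 0<1)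

  p≤∣p∣ : ∀ p → p ≤ ∣ p ∣
  p≤∣p∣ p with ℚ.≤-total 0ℚ p
  ... | inj₁ 0≤p = ℚ.≤-reflexive (sym (ℚ.0≤p⇒∣p∣≡p 0≤p))
  ... | inj₂ p≤0 = ℚ.≤-trans p≤0 (ℚ.0≤∣p∣ p)

  eventually-small : ∀ {x} y → 0ℚ < x → Eventually (λ ε → ε * y < x)
  eventually-small {x} y 0<x =
    let δ , 0<δ , B*δ≡x = divide B x 0<B 0<x
    in δ , 0<δ , λ ε 0<ε ε≤δ → begin-strict
      ε * y    <⟨ ℚ.*-monoʳ-<-pos ε {{ℚ.positive 0<ε}} (ℚ.≤-<-trans (p≤∣p∣ y) (p<1+p ∣ y ∣)) ⟩
      ε * B    ≤⟨ ℚ.*-monoʳ-≤-nonNeg B {{ℚ.nonNegative (ℚ.<⇒≤ 0<B)}} ε≤δ ⟩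
      δ * B    ≡⟨ ℚ.*-comm δ B ⟩
      B * δ    ≡⟨ B*δ≡x ⟩
      x        ∎
    where
    open ℚ.≤-Reasoning
    -- The summand 1 keeps the divisor positive when `y` is 0, and makes `y` strictly smaller than
    -- `B`.
    B = 1ℚ + ∣ y ∣
    0<B : 0ℚ < B
    0<B = ℚ.<-≤-trans 0<1 (subst (_≤ B) (ℚ.+-identityʳ 1ℚ) (ℚ.+-monoʳ-≤ 1ℚ (ℚ.0≤∣p∣ y)))

  0<q-p : ∀ {p q} → p < q → 0ℚ < q - p
  0<q-p {p} {q} p<q = subst (_< q - p) (ℚ.+-inverseʳ p) (ℚ.+-monoˡ-< (- p) p<q)

  0<q-p⇒p<q : ∀ {p q} → 0ℚ < q - p → p < q
  0<q-p⇒p<q {p} {q} 0<q-p = subst₂ _<_ (ℚ.+-identityˡ p)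
    (solve 2 (λ p q → (q :- p) :+ p := q) refl p q) (ℚ.+-monoˡ-< p 0<q-p)

  0≤q-p : ∀ {p q} → p ≤ q → 0ℚ ≤ q - p
  0≤q-p {p} {q} p≤q = subst (_≤ q - p) (ℚ.+-inverseʳ p) (ℚ.+-monoˡ-≤ (- p) p≤q)

  0≤q-p⇒p≤q : ∀ {p q} → 0ℚ ≤ q - p → p ≤ q
  0≤q-p⇒p≤q {p} {q} 0≤ = subst₂ _≤_ (ℚ.+-identityˡ p)
    (solve 2 (λ p q → (q :- p) :+ p := q) refl p q) (ℚ.+-monoˡ-≤ p 0≤)

  abstract
    -- Separating functions expand this way in ε: `a` compares letters, `b` compares times, and `c`
    -- is an error term. Outside this block it is opened only by `quadratic-def`.
    quadratic : ℚ → ℚ → ℚ → ℚ → ℚ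
    quadratic a b c ε = a + ε * (b + ε * c)

    quadratic-def : ∀ a b c ε → quadratic a b c ε ≡ a + ε * (b + ε * c)
    quadratic-def a b c ε = refl

    -- Cancelling the equal constant terms and a factor ε leaves `ε * (c - c′) < b′ - b`.
    eventually-<-linear : ∀ {a a′ b b′} c c′ → a ≡ a′ → b < b′ →
      Eventually (λ ε → quadratic a b c ε < quadratic a′ b′ c′ ε)
    eventually-<-linear {a} {_} {b} {b′} c c′ refl b<b′ = eventually-map
      (λ ε 0<ε small → ℚ.+-monoʳ-< a (ℚ.*-monoʳ-<-pos ε {{ℚ.positive 0<ε}}
        (0<q-p⇒p<q (subst (0ℚ <_)
          (solve 5 (λ b b′ c c′ ε → (b′ :- b) :- ε :* (c :- c′) := (b′ :+ ε :* c′) :- (b :+ ε :* c))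
            refl b b′ c c′ ε)
          (0<q-p small)))))
      (eventually-small (c - c′) (0<q-p b<b′))

    eventually-<-constant : ∀ {a a′} b b′ c c′ → a < a′ →
      Eventually (λ ε → quadratic a b c ε < quadratic a′ b′ c′ ε)
    eventually-<-constant {a} {a′} b b′ c c′ a<a′ = eventually-zip
      -- First `ε * c` is replaced by the larger `1ℚ + ε * c′`; the quadratic terms then cancel, and
      -- what remains is linear in ε.
      (λ ε 0<ε small₁ small₂ → ℚ.<-trans
        (ℚ.+-monoʳ-< a (ℚ.*-monoʳ-<-pos ε {{ℚ.positive 0<ε}}
          (ℚ.+-monoʳ-< b (0<q-p⇒p<q (subst (0ℚ <_)
            (solve 3 (λ c c′ ε → con 1ℚ :- ε :* (c :- c′) := (con 1ℚ :+ ε :* c′) :- ε :* c)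
              refl c c′ ε)
            (0<q-p small₁))))))
        (0<q-p⇒p<q (subst (0ℚ <_)
          (solve 6 (λ a a′ b b′ c′ ε → (a′ :- a) :- ε :* (con 1ℚ :+ (b :- b′)) :=
                      (a′ :+ ε :* (b′ :+ ε :* c′)) :- (a :+ ε :* (b :+ (con 1ℚ :+ ε :* c′))))
            refl a a′ b b′ c′ ε)
          (0<q-p small₂))))
      (eventually-small (c - c′) 0<1)
      (eventually-small (1ℚ + (b - b′)) (0<q-p a<a′))

open Eventuality

-- The rotating tetrahedron and functionals on it.

module Letters where
  open import Data.Rational.Base using (_+_; _*_; _-_; -_; _<_; _≤_)
  open +-*-Solver using (solve; _:=_; _:+_; _:*_; _:-_; :-_; con)

  -- The rotation field of a tetrahedron about the axis through its
  -- vertex 0F.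
  spin : Fin 4 → Fin 4 → ℚ
  spin 0F b = 0ℚ
  spin 1F b = δ 2F b - δ 3F b
  spin 2F b = δ 3F b - δ 1F b
  spin 3F b = δ 1F b - δ 2F b

  -- For different letters this is the difference of the indicators of the two remaining letters,
  -- signed so that `spinOf` grows by 2 from `p` to `q`. It vanishes at `p` and `q`, so it can
  -- change their speeds without changing their heights.
  tilt : Fin 4 → Fin 4 → Fin 4 → ℚ
  tilt 0F q  b = spin q b
  tilt p  0F b = - spin p b
  tilt 1F 2F b = δ 3F b - δ 0F b
  tilt 2F 3F b = δ 1F b - δ 0F b
  tilt 3F 1F b = δ 2F b - δ 0F b
  tilt 2F 1F b = δ 0F b - δ 3F b
  tilt 3F 2F b = δ 0F b - δ 1F b
  tilt 1F 3F b = δ 0F b - δ 2F b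
  -- Reached only by equal letters other than `0F`; the value 0 keeps the sum over `b` zero there
  -- too.
  tilt _  _  b = 0ℚ

  -- Derivative along the rotation, at vertex `a`, of the affine functional with value `f b` at each
  -- vertex `b`.
  spinOf : (Fin 4 → ℚ) → Fin 4 → ℚ
  spinOf f a = ∑ (λ b → f b * spin a b)

  height : Fin 4 → Fin 4 → ℚ → Fin 4 → ℚ
  height p q z b = (δ q b - δ p b) + z * tilt p q b

  height-min : ∀ {p q} z → p ≢ q → height p q z p ≡ - 1ℚ
  height-min {p} {q} z p≢q = lemma (check p q p≢q)
    where
    check : ∀ p q → p ≢ q → δ q p - δ p p ≡ - 1ℚ × tilt p q p ≡ 0ℚ
    check = from-yes (Fin.all? λ p → Fin.all? λ q → ¬? (p Fin.≟ q) →-dec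
      (δ q p - δ p p ℚ.≟ - 1ℚ) ×-dec (tilt p q p ℚ.≟ 0ℚ))
    lemma : ∀ {x y} → x ≡ - 1ℚ × y ≡ 0ℚ → x + z * y ≡ - 1ℚ
    lemma (refl , refl) = trans (cong ((- 1ℚ) +_) (ℚ.*-zeroʳ z)) (ℚ.+-identityʳ (- 1ℚ))

  height-max : ∀ {p q} z → p ≢ q → height p q z q ≡ 1ℚ
  height-max {p} {q} z p≢q = lemma (check p q p≢q)
    where
    check : ∀ p q → p ≢ q → δ q q - δ p q ≡ 1ℚ × tilt p q q ≡ 0ℚ
    check = from-yes (Fin.all? λ p → Fin.all? λ q → ¬? (p Fin.≟ q) →-dec
      (δ q q - δ p q ℚ.≟ 1ℚ) ×-dec (tilt p q q ℚ.≟ 0ℚ))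
    lemma : ∀ {x y} → x ≡ 1ℚ × y ≡ 0ℚ → x + z * y ≡ 1ℚ
    lemma (refl , refl) = trans (cong (1ℚ +_) (ℚ.*-zeroʳ z)) (ℚ.+-identityʳ 1ℚ)

  module _ {z} (0≤z : 0ℚ ≤ z) (z<1 : z < 1ℚ) where

    private
      z*≤ : ∀ {t} → t ≤ 1ℚ → z * t < 1ℚ
      z*≤ {t} t≤1 = ℚ.≤-<-trans
        (subst (z * t ≤_) (ℚ.*-identityʳ z) (ℚ.*-monoˡ-≤-nonNeg z {{ℚ.nonNegative 0≤z}} t≤1)) z<1

      ≤z* : ∀ {t} → - 1ℚ ≤ t → - 1ℚ < z * t
      ≤z* {t} -1≤t = ℚ.<-≤-trans (ℚ.neg-antimono-< z<1)
        (subst (_≤ z * t) (solve 1 (λ z → z :* con (- 1ℚ) := :- z) refl z)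
          (ℚ.*-monoˡ-≤-nonNeg z {{ℚ.nonNegative 0≤z}} -1≤t))

    -- Away from `p` the untilted height is at least 0, and the tilt contributes more than -1
    -- because its values are at least -1 and `z` is below 1.
    height-min< : ∀ {p q a} → p ≢ q → a ≢ p → - 1ℚ < height p q z a
    height-min< {p} {q} {a} p≢q a≢p =
      let 0≤ , -1≤ = check p q a p≢q a≢p
      in subst (_< height p q z a) (ℚ.+-identityˡ (- 1ℚ)) (ℚ.+-mono-≤-< 0≤ (≤z* -1≤))
      where
      check : ∀ p q a → p ≢ q → a ≢ p → 0ℚ ≤ δ q a - δ p a × - 1ℚ ≤ tilt p q a
      check = from-yes (Fin.all? λ p → Fin.all? λ q → Fin.all? λ a →
        ¬? (p Fin.≟ q) →-dec ¬? (a Fin.≟ p) →-dec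
        (0ℚ ℚ.≤? δ q a - δ p a) ×-dec (- 1ℚ ℚ.≤? tilt p q a))

    height<max : ∀ {p q a} → p ≢ q → a ≢ q → height p q z a < 1ℚ
    height<max {p} {q} {a} p≢q a≢q =
      let ≤0 , ≤1 = check p q a p≢q a≢q
      in subst (height p q z a <_) (ℚ.+-identityˡ 1ℚ) (ℚ.+-mono-≤-< ≤0 (z*≤ ≤1))
      where
      check : ∀ p q a → p ≢ q → a ≢ q → δ q a - δ p a ≤ 0ℚ × tilt p q a ≤ 1ℚ
      check = from-yes (Fin.all? λ p → Fin.all? λ q → Fin.all? λ a →
        ¬? (p Fin.≟ q) →-dec ¬? (a Fin.≟ q) →-dec
        (δ q a - δ p a ℚ.≤? 0ℚ) ×-dec (tilt p q a ℚ.≤? 1ℚ))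

  -- Such a functional vanishes at the centre, so the pull towards the centre contributes only a
  -- multiple of its value at the vertex.
  height-balanced : ∀ {p q} z → p ≢ q → ∑ (height p q z) ≡ 0ℚ
  height-balanced {p} {q} z p≢q = begin
    ∑ (λ b → (δ q b - δ p b) + z * tilt p q b)
      ≡⟨ ∑-distrib-+ (λ b → δ q b - δ p b) (λ b → z * tilt p q b) ⟩
    ∑ (λ b → δ q b - δ p b) + ∑ (λ b → z * tilt p q b)
      ≡⟨ cong (∑ (λ b → δ q b - δ p b) +_) (*-distribˡ-sum z (tilt p q)) ⟨
    ∑ (λ b → δ q b - δ p b) + z * ∑ (tilt p q)
      ≡⟨ cong₂ (λ x y → x + z * y) (proj₁ (check p q)) (proj₂ (check p q)) ⟩
    0ℚ + z * 0ℚ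
      ≡⟨ solve 1 (λ z → con 0ℚ :+ z :* con 0ℚ := con 0ℚ) refl z ⟩
    0ℚ ∎
    where
    open ≡-Reasoning
    check : ∀ p q → ∑ (λ b → δ q b - δ p b) ≡ 0ℚ × ∑ (tilt p q) ≡ 0ℚ
    check = from-yes (Fin.all? λ p → Fin.all? λ q →
      (∑ (λ b → δ q b - δ p b) ℚ.≟ 0ℚ) ×-dec (∑ (tilt p q) ℚ.≟ 0ℚ))

  spinOf-height : ∀ p q z a →
    spinOf (height p q z) a ≡ spinOf (λ b → δ q b - δ p b) a + z * spinOf (tilt p q) a
  spinOf-height p q z a = begin
    ∑ (λ b → ((δ q b - δ p b) + z * tilt p q b) * spin a b)
      ≡⟨ sum-cong-≗ (λ b → solve 4 (λ d z t s → (d :+ z :* t) :* s := d :* s :+ z :* (t :* s)) refl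
           (δ q b - δ p b) z (tilt p q b) (spin a b)) ⟩
    ∑ (λ b → (δ q b - δ p b) * spin a b + z * (tilt p q b * spin a b))
      ≡⟨ ∑-distrib-+ (λ b → (δ q b - δ p b) * spin a b) (λ b → z * (tilt p q b * spin a b)) ⟩
    spinOf (λ b → δ q b - δ p b) a + ∑ (λ b → z * (tilt p q b * spin a b))
      ≡⟨ cong (spinOf (λ b → δ q b - δ p b) a +_)
           (*-distribˡ-sum z (λ b → tilt p q b * spin a b)) ⟨
    spinOf (λ b → δ q b - δ p b) a + z * spinOf (tilt p q) a ∎
    where open ≡-Reasoning

  -- Antisymmetry of the rotation makes the speeds at p and q equal for
  -- z = 0; tilting lets their difference be prescribed.
  spin-difference : ∀ {p q} z → p ≢ q →
    spinOf (height p q z) q ≡ spinOf (height p q z) p + (z + z)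
  spin-difference {p} {q} z p≢q = begin
    spinOf (height p q z) q
      ≡⟨ spinOf-height p q z q ⟩
    spinOf (λ b → δ q b - δ p b) q + z * spinOf (tilt p q) q
      ≡⟨ cong₂ (λ x y → x + z * y) (proj₁ (check p q p≢q)) (proj₂ (check p q p≢q)) ⟩
    spinOf (λ b → δ q b - δ p b) p + z * (spinOf (tilt p q) p + (1ℚ + 1ℚ))
      ≡⟨ solve 3 (λ x y z → x :+ z :* (y :+ (con 1ℚ :+ con 1ℚ)) := (x :+ z :* y) :+ (z :+ z)) refl
           (spinOf (λ b → δ q b - δ p b) p) (spinOf (tilt p q) p) z ⟩
    (spinOf (λ b → δ q b - δ p b) p + z * spinOf (tilt p q) p) + (z + z)
      ≡⟨ cong (_+ (z + z)) (spinOf-height p q z p) ⟨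
    spinOf (height p q z) p + (z + z) ∎
    where
    open ≡-Reasoning
    check : ∀ p q → p ≢ q →
      spinOf (λ b → δ q b - δ p b) q ≡ spinOf (λ b → δ q b - δ p b) p ×
      spinOf (tilt p q) q ≡ spinOf (tilt p q) p + (1ℚ + 1ℚ)
    check = from-yes (Fin.all? λ p → Fin.all? λ q → ¬? (p Fin.≟ q) →-dec
      (spinOf (λ b → δ q b - δ p b) q ℚ.≟ spinOf (λ b → δ q b - δ p b) p) ×-dec
      (spinOf (tilt p q) q ℚ.≟ spinOf (tilt p q) p + (1ℚ + 1ℚ)))

open Letters

0<x*x : ∀ {x} → 0ℚ ℚ.< x → 0ℚ ℚ.< x ℚ.* x
0<x*x {x} 0<x = subst (ℚ._< x ℚ.* x) (ℚ.*-zeroʳ x) (ℚ.*-monoʳ-<-pos x {{ℚ.positive 0<x}} 0<x)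

-- Words, their times, and the moving tetrahedra.

module Words (k : ℕ) where
  open import Defs using (divide)
  open import Data.Rational.Base using (_+_; _*_; _-_; -_; _<_; _≤_)
  open +-*-Solver using (solve; _:=_; _:+_; _:*_; _:-_; :-_; con)

  -- An iterated sum rather than a fraction, so that `ι (suc n)` is `1ℚ + ι n` by definition.
  ι : ℕ → ℚ
  ι n = n · 1ℚ

  ι-nonNeg : ∀ n → 0ℚ ≤ ι n
  ι-nonNeg zero    = ℚ.≤-refl
  ι-nonNeg (suc n) = ℚ.≤-trans (ι-nonNeg n) (ℚ.<⇒≤ (p<1+p (ι n)))

  ι-mono-< : ∀ {m n} → m ℕ.< n → ι m < ι n
  ι-mono-< {zero}  {suc n} _         = ℚ.≤-<-trans (ι-nonNeg n) (p<1+p (ι n))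
  ι-mono-< {suc m} {suc n} (s≤s m<n) = ℚ.+-monoʳ-< 1ℚ (ι-mono-< m<n)

  -- Base 4 place values, with the leading digit first as in `funToFin`.
  place : ∀ {n} → Fin n → ℕ
  place {suc n} zero    = 4 ℕ.^ n
  place {suc n} (suc j) = place j

  -- This additivity over the letters lets `clock` recover the time from the coordinates.
  ι-funToFin : ∀ {n} (f : Fin n → Fin 4) →
    ι (toℕ (funToFin f)) ≡ ∑ (λ j → ι (place j ℕ.* toℕ (f j)))
  ι-funToFin {zero}  f = refl
  ι-funToFin {suc n} f = begin
    ι (toℕ (combine (f zero) r))
      ≡⟨ cong ι (Fin.toℕ-combine (f zero) r) ⟩
    ι (4 ℕ.^ n ℕ.* toℕ (f zero) ℕ.+ toℕ r)
      ≡⟨ ×-homo-+ 1ℚ (4 ℕ.^ n ℕ.* toℕ (f zero)) (toℕ r) ⟩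
    ι (4 ℕ.^ n ℕ.* toℕ (f zero)) + ι (toℕ r)
      ≡⟨ cong (ι (4 ℕ.^ n ℕ.* toℕ (f zero)) +_) (ι-funToFin (f ∘ suc)) ⟩
    ∑ (λ j → ι (place j ℕ.* toℕ (f j))) ∎
    where
    open ≡-Reasoning
    r = funToFin (f ∘ suc)

  Word : Set
  Word = Fin (4 ℕ.^ k)

  letter : Word → Fin k → Fin 4
  letter = finToFun {4} {k}

  private
    bound : ℚ
    -- Twice the number of words: all times are then below ½, and sums of two of them are admissible
    -- tilts.
    bound = ι (4 ℕ.^ k) + ι (4 ℕ.^ k)

    ι-word< : (w : Word) → ι (toℕ w) < ι (4 ℕ.^ k)
    ι-word< w = ι-mono-< (Fin.toℕ<n w)

    0<bound : 0ℚ < bound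
    0<bound = ℚ.+-mono-< 0<ιN 0<ιN
      where
      0<ιN : 0ℚ < ι (4 ℕ.^ k)
      0<ιN = ι-mono-< (ℕ.m^n>0 4 k)

    scale-∃ : ∃[ c ] (0ℚ < c × bound * c ≡ 1ℚ)
    scale-∃ = divide bound 1ℚ 0<bound 0<1

  scale : ℚ
  scale = proj₁ scale-∃

  private
    instance
      scale-pos : ℚ.Positive scale
      scale-pos = ℚ.positive (proj₁ (proj₂ scale-∃))
      scale-nonNeg : ℚ.NonNegative scale
      scale-nonNeg = ℚ.pos⇒nonNeg scale

  time : Fn (4 ℕ.^ k)
  time w = scale * ι (toℕ w)

  time-nonNeg : ∀ w → 0ℚ ≤ time w
  time-nonNeg w = subst (_≤ time w) (ℚ.*-zeroʳ scale)
    (ℚ.*-monoˡ-≤-nonNeg scale (ι-nonNeg (toℕ w)))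

  time+time<1 : ∀ u v → time u + time v < 1ℚ
  time+time<1 u v = begin-strict
    scale * ι (toℕ u) + scale * ι (toℕ v)  ≡⟨ ℚ.*-distribˡ-+ scale (ι (toℕ u)) (ι (toℕ v)) ⟨
    scale * (ι (toℕ u) + ι (toℕ v))        <⟨ ℚ.*-monoʳ-<-pos scale (ℚ.+-mono-< (ι-word< u) (ι-word< v)) ⟩
    scale * bound                          ≡⟨ ℚ.*-comm scale bound ⟩
    bound * scale                          ≡⟨ proj₂ (proj₂ scale-∃) ⟩
    1ℚ                                     ∎
    where open ℚ.≤-Reasoning

  time-< : ∀ {u v} → u Fin.< v → time u < time v
  time-< u<v = ℚ.*-monoʳ-<-pos scale (ι-mono-< u<v)

  weight : Fin k → Fin 4 → ℚ
  weight j b = scale * ι (place j ℕ.* toℕ b)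

  ∑-weight : ∀ w → ∑ (λ j → weight j (letter w j)) ≡ time w
  ∑-weight w = begin
    ∑ (λ j → weight j (letter w j))
      ≡⟨ *-distribˡ-sum scale (λ j → ι (place j ℕ.* toℕ (letter w j))) ⟨
    scale * ∑ (λ j → ι (place j ℕ.* toℕ (letter w j)))
      ≡⟨ cong (scale *_) (ι-funToFin (letter w)) ⟨
    scale * ι (toℕ (funToFin (letter w)))
      ≡⟨ cong (λ w → scale * ι (toℕ w)) (Fin.funToFin-finToFin {k} {4} w) ⟩
    time w ∎
    where open ≡-Reasoning

  -- Injectivity of `time`, in the form in which the parabolas use it.
  square-pos : ∀ {u v} → u ≢ v → 0ℚ < (time u - time v) * (time u - time v)
  square-pos {u} {v} u≢v with Fin.<-cmp u v
  ... | tri≈ _ u≡v _ = contradiction u≡v u≢v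
  ... | tri> _ _ v<u = 0<x*x (0<q-p (time-< v<u))
  ... | tri< u<v _ _ = subst (0ℚ <_)
    (solve 2 (λ x y → (y :- x) :* (y :- x) := (x :- y) :* (x :- y)) refl (time u) (time v))
    (0<x*x (0<q-p (time-< u<v)))

  -- Times are sums over letters, so words with equal letters would have equal times, against
  -- `square-pos`.
  differentLetter : ∀ {u v} → u ≢ v → ∃[ j ] letter u j ≢ letter v j
  differentLetter {u} {v} u≢v with Fin.any? (λ j → ¬? (letter u j Fin.≟ letter v j))
  ... | yes found = found
  ... | no ¬found = contradiction (square-pos u≢v) (ℚ.<-irrefl (sym square≡0))
    where
    time≡ : time u ≡ time v
    time≡ = trans (sym (∑-weight u)) (trans
      (sum-cong-≗ (λ j → cong (weight j)
        (decidable-stable (letter u j Fin.≟ letter v j) (λ ≢ → ¬found (j , ≢)))))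
      (∑-weight v))
    square≡0 : (time u - time v) * (time u - time v) ≡ 0ℚ
    square≡0 = trans (cong (λ x → (x - time v) * (x - time v)) time≡)
      (solve 1 (λ x → (x :- x) :* (x :- x) := con 0ℚ) refl (time v))

  -- With this constant the four barycentric coordinates of a block sum
  -- to 1, so that three of them suffice.
  ¼ : ℚ
  ¼ = ½ * ½

  -- The rotation is linear in the time; the pull towards the centre, whose barycentric coordinates
  -- are all `¼`, is quadratic.
  motion : Fin k → Fin 4 → Fn (4 ℕ.^ k)
  motion j b w = time w * spin (letter w j) b + time w * time w * (¼ - δ b (letter w j))

  barycentric : ℚ → Fin k → Fin 4 → Fn (4 ℕ.^ k)
  barycentric ε j b w = δ b (letter w j) + ε * motion j b w

  ∑-+-* : ∀ {n} ε (x y : Fin n → ℚ) → ∑ (λ i → x i + ε * y i) ≡ ∑ x + ε * ∑ y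
  ∑-+-* ε x y = trans (∑-distrib-+ x (λ i → ε * y i))
    (cong (∑ x +_) (sym (*-distribˡ-sum ε y)))

  ∑-motion≡0 : ∀ j w → ∑ (λ b → motion j b w) ≡ 0ℚ
  ∑-motion≡0 j w = begin
    ∑ (λ b → t * spin a b + t * t * (¼ - δ b a))
      ≡⟨ ∑-+-* (t * t) (λ b → t * spin a b) (λ b → ¼ - δ b a) ⟩
    ∑ (λ b → t * spin a b) + t * t * ∑ (λ b → ¼ - δ b a)
      ≡⟨ cong (_+ t * t * ∑ (λ b → ¼ - δ b a)) (*-distribˡ-sum t (spin a)) ⟨
    t * ∑ (spin a) + t * t * ∑ (λ b → ¼ - δ b a)
      ≡⟨ cong₂ (λ x y → t * x + t * t * y) (proj₁ (check a)) (proj₂ (check a)) ⟩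
    t * 0ℚ + t * t * 0ℚ
      ≡⟨ solve 1 (λ t → t :* con 0ℚ :+ t :* t :* con 0ℚ := con 0ℚ) refl t ⟩
    0ℚ ∎
    where
    open ≡-Reasoning
    t = time w
    a = letter w j
    check : ∀ a → ∑ (spin a) ≡ 0ℚ × ∑ (λ b → ¼ - δ b a) ≡ 0ℚ
    check = from-yes (Fin.all? λ a →
      (∑ (spin a) ℚ.≟ 0ℚ) ×-dec (∑ (λ b → ¼ - δ b a) ℚ.≟ 0ℚ))

  ∑-barycentric≡1 : ∀ ε j w → ∑ (λ b → barycentric ε j b w) ≡ 1ℚ
  ∑-barycentric≡1 ε j w = begin
    ∑ (λ b → δ b a + ε * motion j b w)      ≡⟨ ∑-+-* ε (λ b → δ b a) (λ b → motion j b w) ⟩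
    ∑ (λ b → δ b a) + ε * ∑ (λ b → motion j b w)
      ≡⟨ cong₂ (λ x y → x + ε * y) (∑δ≡1 a) (∑-motion≡0 j w) ⟩
    1ℚ + ε * 0ℚ                             ≡⟨ solve 1 (λ ε → con 1ℚ :+ ε :* con 0ℚ := con 1ℚ) refl ε ⟩
    1ℚ                                      ∎
    where
    open ≡-Reasoning
    a = letter w j
    ∑δ≡1 : ∀ (a : Fin 4) → ∑ (λ b → δ b a) ≡ 1ℚ
    ∑δ≡1 = from-yes (Fin.all? λ (a : Fin 4) → ∑ (λ b → δ b a) ℚ.≟ 1ℚ)

  barycentric-0F : ∀ ε j w →
    1ℚ + (- 1ℚ) * ∑ (λ b → barycentric ε j (suc b) w) ≡ barycentric ε j 0F w
  barycentric-0F ε j w = begin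
    1ℚ + (- 1ℚ) * others
      ≡⟨ cong (_+ (- 1ℚ) * others) (∑-barycentric≡1 ε j w) ⟨
    (barycentric ε j 0F w + others) + (- 1ℚ) * others
      ≡⟨ solve 2 (λ x y → (x :+ y) :+ con (- 1ℚ) :* y := x) refl (barycentric ε j 0F w) others ⟩
    barycentric ε j 0F w ∎
    where
    open ≡-Reasoning
    others = ∑ (λ b → barycentric ε j (suc b) w)

  coordinates : ℚ → Fin (k ℕ.* 3) → Fn (4 ℕ.^ k)
  coordinates ε i = let j , b = remQuot {k} 3 i in barycentric ε j (suc b)

  barycentric∈Span : ∀ ε j b → Span (coordinates ε) (barycentric ε j b)
  barycentric∈Span ε j (suc b) =
    subst (λ (j , b) → Span (coordinates ε) (barycentric ε j (suc b)))
      (Fin.remQuot-combine j b) (gen (combine j b))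
  barycentric∈Span ε j zero = resp (barycentric-0F ε j)
    (const 1ℚ ⊕ (- 1ℚ) ⊙ Span-∑ (λ b → barycentric ε j (suc b)) (λ b → barycentric∈Span ε j (suc b)))

  drift : Fn (4 ℕ.^ k)
  drift w = ∑ (λ j → ∑ (λ b → weight j b * motion j b w))

  -- On unmoved tetrahedra the letter weights add up to the time exactly, so this combination of
  -- coordinates reads the time up to O(ε).
  clock : ℚ → Fn (4 ℕ.^ k)
  clock ε w = ∑ (λ j → ∑ (λ b → weight j b * barycentric ε j b w))

  clock∈Span : ∀ ε → Span (coordinates ε) (clock ε)
  clock∈Span ε = Span-∑ _ λ j → Span-∑ _ λ b → weight j b ⊙ barycentric∈Span ε j b

  ∑-barycentric : ∀ ε j w (g : Fin 4 → ℚ) →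
    ∑ (λ b → g b * barycentric ε j b w) ≡ g (letter w j) + ε * ∑ (λ b → g b * motion j b w)
  ∑-barycentric ε j w g = begin
    ∑ (λ b → g b * (δ b a + ε * motion j b w))
      ≡⟨ sum-cong-≗ (λ b → solve 4 (λ g d ε m → g :* (d :+ ε :* m) := g :* d :+ ε :* (g :* m)) refl
           (g b) (δ b a) ε (motion j b w)) ⟩
    ∑ (λ b → g b * δ b a + ε * (g b * motion j b w))
      ≡⟨ ∑-+-* ε (λ b → g b * δ b a) (λ b → g b * motion j b w) ⟩
    ∑ (λ b → g b * δ b a) + ε * ∑ (λ b → g b * motion j b w)
      ≡⟨ cong (_+ ε * ∑ (λ b → g b * motion j b w)) (∑-δ g a) ⟩
    g a + ε * ∑ (λ b → g b * motion j b w) ∎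
    where
    open ≡-Reasoning
    a = letter w j

  clock≡ : ∀ ε w → clock ε w ≡ time w + ε * drift w
  clock≡ ε w = begin
    ∑ (λ j → ∑ (λ b → weight j b * barycentric ε j b w))
      ≡⟨ sum-cong-≗ (λ j → ∑-barycentric ε j w (weight j)) ⟩
    ∑ (λ j → weight j (letter w j) + ε * ∑ (λ b → weight j b * motion j b w))
      ≡⟨ ∑-+-* ε (λ j → weight j (letter w j)) (λ j → ∑ (λ b → weight j b * motion j b w)) ⟩
    ∑ (λ j → weight j (letter w j)) + ε * drift w
      ≡⟨ cong (_+ ε * drift w) (∑-weight w) ⟩
    time w + ε * drift w ∎
    where open ≡-Reasoning

  -- The centre contributes `t * t * ¼` times the sum of `g`, hence nothing; rotation minus pull
  -- remains.
  ∑-motion : ∀ j w (g : Fin 4 → ℚ) → ∑ g ≡ 0ℚ → ∑ (λ b → g b * motion j b w) ≡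
    time w * spinOf g (letter w j) - time w * time w * g (letter w j)
  ∑-motion j w g ∑g≡0 = begin
    ∑ (λ b → g b * (t * spin a b + t * t * (¼ - δ b a)))
      ≡⟨ sum-cong-≗ (λ b → solve 4 (λ g t s d →
           g :* (t :* s :+ t :* t :* (con ¼ :- d)) :=
           (t :* t :* con ¼ :* g :+ t :* (g :* s)) :+ (:- (t :* t)) :* (g :* d)) refl
           (g b) t (spin a b) (δ b a)) ⟩
    ∑ (λ b → (t * t * ¼ * g b + t * (g b * spin a b)) + (- (t * t)) * (g b * δ b a))
      ≡⟨ ∑-+-* (- (t * t)) (λ b → t * t * ¼ * g b + t * (g b * spin a b)) (λ b → g b * δ b a) ⟩
    ∑ (λ b → t * t * ¼ * g b + t * (g b * spin a b)) + (- (t * t)) * ∑ (λ b → g b * δ b a)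
      ≡⟨ cong₂ (λ x y → x + (- (t * t)) * y)
           (∑-+-* t (λ b → t * t * ¼ * g b) (λ b → g b * spin a b)) (∑-δ g a) ⟩
    (∑ (λ b → t * t * ¼ * g b) + t * spinOf g a) + (- (t * t)) * g a
      ≡⟨ cong (λ x → (x + t * spinOf g a) + (- (t * t)) * g a)
           (trans (sym (*-distribˡ-sum (t * t * ¼) g)) (cong (t * t * ¼ *_) ∑g≡0)) ⟩
    (t * t * ¼ * 0ℚ + t * spinOf g a) + (- (t * t)) * g a
      ≡⟨ solve 3 (λ t s g → (t :* t :* con ¼ :* con 0ℚ :+ t :* s) :+ (:- (t :* t)) :* g :=
                    t :* s :- t :* t :* g) refl t (spinOf g a) (g a) ⟩
    t * spinOf g a - t * t * g a ∎
    where
    open ≡-Reasoning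
    t = time w
    a = letter w j

  -- The separating function of two words.

  module _ (u v : Word) (j : Fin k) (u≢v : letter u j ≢ letter v j) where

    private
      p = letter u j
      q = letter v j
      -- A parabola vertex at `time u` for letter `p` fixes `speed`; one at `time v` for letter `q`
      -- then requires a spin difference of twice this sum.
      z = time u + time v

      0≤z : 0ℚ ≤ z
      0≤z = ℚ.+-mono-≤ (time-nonNeg u) (time-nonNeg v)

      f : Fin 4 → ℚ
      f = height p q z

    -- The multiple of the time to subtract so that the parabola for letter `p` has its lowest point
    -- at `time u`.
    speed : ℚ
    speed = spinOf f p + (time u + time u)

    first : Fn (4 ℕ.^ k)
    first w = time w * spinOf f (letter w j) - time w * time w * f (letter w j) - speed * time w

    separator : ℚ → Fn (4 ℕ.^ k)
    separator ε w = ∑ (λ b → f b * barycentric ε j b w) + (- (ε * speed)) * clock ε w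

    separator∈Span : ∀ ε → Span (coordinates ε) (separator ε)
    separator∈Span ε = Span-∑ _ (λ b → f b ⊙ barycentric∈Span ε j b)
      ⊕ (- (ε * speed)) ⊙ clock∈Span ε

    -- The clock enters with a factor ε, so its own error appears only at second order.
    separator≡ : ∀ ε w → separator ε w ≡
      quadratic (f (letter w j)) (first w) (- (speed * drift w)) ε
    separator≡ ε w = trans (trans
      (cong₂ (λ x y → x + (- (ε * speed)) * y)
        (trans (∑-barycentric ε j w f)
          (cong (λ x → f (letter w j) + ε * x) (∑-motion j w f (height-balanced z u≢v))))
        (clock≡ ε w))
      (solve 6 (λ f ε m l t d →
          (f :+ ε :* m) :+ (:- (ε :* l)) :* (t :+ ε :* d) :=
          f :+ ε :* ((m :- l :* t) :+ ε :* (:- (l :* d))))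
        refl (f (letter w j)) ε _ speed (time w) (drift w)))
      (sym (quadratic-def (f (letter w j)) (first w) (- (speed * drift w)) ε))

    -- At height -1 the pull gives `+ t²`, and the choice of `speed` completes the square.
    first-min : ∀ {w} → letter w j ≡ p →
      first w ≡ (time w - time u) * (time w - time u) - time u * time u
    first-min {w} eq = begin
      first w
        ≡⟨ cong (λ a → time w * spinOf f a - time w * time w * f a - speed * time w) eq ⟩
      time w * spinOf f p - time w * time w * f p - speed * time w
        ≡⟨ cong (λ x → time w * spinOf f p - time w * time w * x - speed * time w)
             (height-min z u≢v) ⟩
      time w * spinOf f p - time w * time w * (- 1ℚ) - speed * time w
        ≡⟨ solve 3 (λ t c s → t :* s :- t :* t :* con (- 1ℚ) :- (s :+ (c :+ c)) :* t :=
                      (t :- c) :* (t :- c) :- c :* c) refl (time w) (time u) (spinOf f p) ⟩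
      (time w - time u) * (time w - time u) - time u * time u ∎
      where open ≡-Reasoning

    -- At height 1 the parabola opens downwards, and the choice of `z` moves its top to `time v`.
    first-max : ∀ {w} → letter w j ≡ q →
      first w ≡ time v * time v - (time w - time v) * (time w - time v)
    first-max {w} eq = begin
      first w
        ≡⟨ cong (λ a → time w * spinOf f a - time w * time w * f a - speed * time w) eq ⟩
      time w * spinOf f q - time w * time w * f q - speed * time w
        ≡⟨ cong₂ (λ x y → time w * x - time w * time w * y - speed * time w)
             (spin-difference z u≢v) (height-max z u≢v) ⟩
      time w * (spinOf f p + (z + z)) - time w * time w * 1ℚ - speed * time w
        ≡⟨ solve 4 (λ t c d s →
                      t :* (s :+ ((c :+ d) :+ (c :+ d))) :- t :* t :* con 1ℚ :-
                        (s :+ (c :+ c)) :* t :=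
                      d :* d :- (t :- d) :* (t :- d))
             refl (time w) (time u) (time v) (spinOf f p) ⟩
      time v * time v - (time w - time v) * (time w - time v) ∎
      where open ≡-Reasoning


    -- A word with another letter in block `j` is higher at order zero; one with the same letter is
    -- higher at first order, by the squared time gap.
    eventually-minimal : ∀ w → Dec (w ≡ u) → Eventually (λ ε → w ≢ u → separator ε u < separator ε w)
    eventually-minimal w (yes w≡u) = always λ _ _ w≢u → contradiction w≡u w≢u
    eventually-minimal w (no  w≢u) = eventually-map
      (λ ε _ lt _ → subst₂ _<_ (sym (separator≡ ε u)) (sym (separator≡ ε w)) lt)
      (compare (letter w j Fin.≟ p))
      where
      compare : Dec (letter w j ≡ p) → Eventually (λ ε →
        quadratic (f p) (first u) (- (speed * drift u)) ε <
        quadratic (f (letter w j)) (first w) (- (speed * drift w)) ε)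
      compare (no  a≢p) = eventually-<-constant (first u) (first w) (- (speed * drift u)) (- (speed * drift w))
        (subst (_< f (letter w j)) (sym (height-min z u≢v))
          (height-min< 0≤z (time+time<1 u v) u≢v a≢p))
      compare (yes a≡p) = eventually-<-linear (- (speed * drift u)) (- (speed * drift w)) (cong f (sym a≡p))
        (subst₂ _<_
          (trans (solve 1 (λ x → con 0ℚ :- x :* x := (x :- x) :* (x :- x) :- x :* x) refl (time u))
            (sym (first-min {u} refl)))
          (sym (first-min {w} a≡p))
          (ℚ.+-monoˡ-< (- (time u * time u)) (square-pos w≢u)))

    eventually-maximal : ∀ w → Dec (w ≡ v) → Eventually (λ ε → w ≢ v → separator ε w < separator ε v)
    eventually-maximal w (yes w≡v) = always λ _ _ w≢v → contradiction w≡v w≢v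
    eventually-maximal w (no  w≢v) = eventually-map
      (λ ε _ lt _ → subst₂ _<_ (sym (separator≡ ε w)) (sym (separator≡ ε v)) lt)
      (compare (letter w j Fin.≟ q))
      where
      compare : Dec (letter w j ≡ q) → Eventually (λ ε →
        quadratic (f (letter w j)) (first w) (- (speed * drift w)) ε <
        quadratic (f q) (first v) (- (speed * drift v)) ε)
      compare (no  a≢q) = eventually-<-constant (first w) (first v) (- (speed * drift w)) (- (speed * drift v))
        (subst (f (letter w j) <_) (sym (height-max z u≢v))
          (height<max 0≤z (time+time<1 u v) u≢v a≢q))
      compare (yes a≡q) = eventually-<-linear (- (speed * drift w)) (- (speed * drift v)) (cong f a≡q)
        (subst₂ _<_
          (sym (first-max {w} a≡q))
          (trans (solve 1 (λ x → x :* x :- con 0ℚ := x :* x :- (x :- x) :* (x :- x)) refl (time v))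
            (sym (first-max {v} refl)))
          (ℚ.+-monoʳ-< (time v * time v) (ℚ.neg-antimono-< (square-pos w≢v))))

    eventually-separates : Eventually (λ ε → Separates (separator ε) u v)
    eventually-separates = eventually-zip
      (λ _ _ min max → record { minimal = min ; maximal = max })
      (eventually-∀ λ w → eventually-minimal w (w Fin.≟ u))
      (eventually-∀ λ w → eventually-maximal w (w Fin.≟ v))

  -- There are finitely many pairs of words, so one ε serves them all.
  eventually-separating : Eventually (λ ε → Separating (coordinates ε))
  eventually-separating = eventually-∀ λ u → eventually-∀ λ v → pair u v (u Fin.≟ v)
    where
    pair : ∀ u v → Dec (u ≡ v) → Eventually (λ ε → u ≢ v →
      ∃[ h ] (Span (coordinates ε) h × Separates h u v))
    pair u v (yes u≡v) = always λ _ _ u≢v → contradiction u≡v u≢v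
    pair u v (no  u≢v) =
      let j , a≢b = differentLetter u≢v
      in eventually-map (λ ε _ sep _ → separator u v j a≢b ε , separator∈Span u v j a≢b ε , sep)
        (eventually-separates u v j a≢b)

  separatingCoordinates : ∃[ F ] Separating {4 ℕ.^ k} {k ℕ.* 3} F
  separatingCoordinates =
    let ε , 0<ε , separating = eventually-separating
    in coordinates ε , separating ε 0<ε ℚ.≤-refl

open Words using (separatingCoordinates)

open import Defs
open import Data.Integer.Base using (+_)

-- Equality and order of Cauchy reals.

module Reals where
  open +-*-Solver using (solve; _:=_; _:+_; _:*_; _:-_; :-_; con)

  pointwise-≈ : ∀ x y → (∀ n → seq x n ≡ seq y n) → x ≈ y
  pointwise-≈ x y x≡y ε 0<ε = 0 , λ n _ → subst (ℚ._< ε)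
    (cong ∣_∣ (sym (trans (cong (ℚ._- seq y n) (x≡y n)) (ℚ.+-inverseʳ (seq y n))))) 0<ε

  ≈-refl : ∀ x → x ≈ x
  ≈-refl x = pointwise-≈ x x λ _ → refl

  ∣p-q∣≡∣q-p∣ : ∀ p q → ∣ p ℚ.- q ∣ ≡ ∣ q ℚ.- p ∣
  ∣p-q∣≡∣q-p∣ p q = trans (cong ∣_∣ (solve 2 (λ p q → p :- q := :- (q :- p)) refl p q))
    (ℚ.∣-p∣≡∣p∣ (q ℚ.- p))

  ≈-sym : ∀ x y → x ≈ y → y ≈ x
  ≈-sym x y x≈y ε 0<ε =
    let N , close = x≈y ε 0<ε
    in N , λ n N≤n → subst (ℚ._< ε) (∣p-q∣≡∣q-p∣ (seq x n) (seq y n)) (close n N≤n)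

  private
    eventually₂ : ∀ {P Q R : ℕ → Set} → (∀ n → P n → Q n → R n) →
      ∃[ N ] (∀ n → N ℕ.≤ n → P n) → ∃[ N ] (∀ n → N ℕ.≤ n → Q n) → ∃[ N ] (∀ n → N ℕ.≤ n → R n)
    eventually₂ f (M , p) (N , q) = M ⊔ N , λ n ≤n →
      f n (p n (ℕ.m⊔n≤o⇒m≤o M N ≤n)) (q n (ℕ.m⊔n≤o⇒n≤o M N ≤n))

  ≈-trans : ∀ x y z → x ≈ y → y ≈ z → x ≈ z
  ≈-trans x y z x≈y y≈z ε 0<ε =
    let δ , 0<δ , δ+δ≡ε = halve ε 0<ε
    in eventually₂
      (λ n xy yz → subst₂ ℚ._<_
        (cong ∣_∣ (solve 3 (λ x y z → (x :+ y) :- (y :+ z) := x :- z) refl (seq x n) (seq y n) (seq z n)))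
        δ+δ≡ε
        (+-close (seq x n) (seq y n) (seq y n) (seq z n) xy yz))
      (x≈y δ 0<δ) (y≈z δ 0<δ)

  +-cong : ∀ x x′ y y′ → x ≈ x′ → y ≈ y′ → x + y ≈ x′ + y′
  +-cong x x′ y y′ x≈x′ y≈y′ ε 0<ε =
    let δ , 0<δ , δ+δ≡ε = halve ε 0<ε
    in eventually₂
      (λ n xx yy → subst (∣ (seq x n ℚ.+ seq y n) ℚ.- (seq x′ n ℚ.+ seq y′ n) ∣ ℚ.<_) δ+δ≡ε
        (+-close (seq x n) (seq y n) (seq x′ n) (seq y′ n) xx yy))
      (x≈x′ δ 0<δ) (y≈y′ δ 0<δ)

  *-congˡ : ∀ z x y → x ≈ y → z * x ≈ z * y
  *-congˡ z x y x≈y ε 0<ε =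
    let B , 0<B , z<B = bounded (cauchy z)
        δ , 0<δ , Bδ≡ε = divide B ε 0<B 0<ε
    in eventually₂
      (λ n zB xy → subst₂ ℚ._<_
        (cong ∣_∣ (solve 3 (λ z x y → z :* (x :- y) := z :* x :- z :* y) refl
          (seq z n) (seq x n) (seq y n)))
        Bδ≡ε
        (*-bound (seq z n) (seq x n ℚ.- seq y n) 0<B zB xy))
      z<B (x≈y δ 0<δ)

  *-comm : ∀ x y → x * y ≈ y * x
  *-comm x y = pointwise-≈ (x * y) (y * x) λ n → ℚ.*-comm (seq x n) (seq y n)

  *-congʳ : ∀ z x y → x ≈ y → x * z ≈ y * z
  *-congʳ z x y x≈y = ≈-trans (x * z) (z * x) (y * z) (*-comm x z)
    (≈-trans (z * x) (z * y) (y * z) (*-congˡ z x y x≈y) (*-comm z y))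

  sum-cong : ∀ {n} (x y : Fin n → ℝ) → (∀ i → x i ≈ y i) → sum x ≈ sum y
  sum-cong {zero}  x y x≈y = ≈-refl 0ℝ
  sum-cong {suc n} x y x≈y = +-cong (x zero) (y zero) (sum (x ∘ suc)) (sum (y ∘ suc))
    (x≈y zero) (sum-cong (x ∘ suc) (y ∘ suc) (x≈y ∘ suc))

  seq-sum : ∀ {n} (x : Fin n → ℝ) k → seq (sum x) k ≡ ∑ (λ i → seq (x i) k)
  seq-sum {zero}  x k = refl
  seq-sum {suc n} x k = cong (seq (x zero) k ℚ.+_) (seq-sum (x ∘ suc) k)

  -- Equality of rationals is decidable, so it suffices to refute `p ≢ q`, taking ε to be their
  -- distance.
  fromℚ-injective : ∀ {p q} → fromℚ p ≈ fromℚ q → p ≡ q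
  fromℚ-injective {p} {q} p≈q = decidable-stable (p ℚ.≟ q) λ p≢q →
    let N , close = p≈q ∣ p ℚ.- q ∣ (0<∣p-q∣ p≢q)
    in ℚ.<-irrefl refl (close N ℕ.≤-refl)
    where
    0<∣p-q∣ : p ≢ q → 0ℚ ℚ.< ∣ p ℚ.- q ∣
    0<∣p-q∣ p≢q = ℚ.≰⇒> λ ≤0 → p≢q (trans
      (solve 2 (λ p q → p := (p :- q) :+ q) refl p q)
      (trans (cong (ℚ._+ q) (ℚ.∣p∣≡0⇒p≡0 (p ℚ.- q) (ℚ.≤-antisym ≤0 (ℚ.0≤∣p∣ (p ℚ.- q)))))
        (ℚ.+-identityˡ q)))

  -- `_<_` asks for a uniform gap and a strict inequality beyond it; the intermediate `q` provides
  -- the gap `q - p` and the strict step from `q` to `r`.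
  <-of-bound : ∀ {p q r} (x : ℝ) → p ℚ.< q → q ℚ.< r → (∀ n → seq x n ℚ.≤ p) → x < fromℚ r
  <-of-bound {p} {q} {r} x p<q q<r x≤p = q ℚ.- p , 0<q-p p<q , 0 , λ n _ → begin-strict
    seq x n ℚ.+ (q ℚ.- p)  ≤⟨ ℚ.+-monoˡ-≤ (q ℚ.- p) (x≤p n) ⟩
    p ℚ.+ (q ℚ.- p)        ≡⟨ solve 2 (λ p q → p :+ (q :- p) := q) refl p q ⟩
    q                      <⟨ q<r ⟩
    r                      ∎
    where open ℚ.≤-Reasoning

  fromℚ-mono-< : ∀ {p q} → p ℚ.< q → fromℚ p < fromℚ q
  fromℚ-mono-< {p} {q} p<q =
    let m , p<m , m<q = ℚ.<-dense p<q
    in <-of-bound (fromℚ p) p<m m<q λ _ → ℚ.≤-refl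

  pointwise-≤ : ∀ x y → (∀ n → seq x n ℚ.≤ seq y n) → x ≤ y
  pointwise-≤ x y x≤y ε 0<ε = 0 , λ n _ → ℚ.≤-<-trans (x≤y n)
    (subst (ℚ._< seq y n ℚ.+ ε) (ℚ.+-identityʳ (seq y n)) (ℚ.+-monoʳ-< (seq y n) 0<ε))

  ≤-trans : ∀ x y z → x ≤ y → y ≤ z → x ≤ z
  ≤-trans x y z x≤y y≤z ε 0<ε =
    let δ , 0<δ , δ+δ≡ε = halve ε 0<ε
    in eventually₂
      (λ n xy yz → ℚ.<-trans xy (subst (seq y n ℚ.+ δ ℚ.<_)
        (trans (ℚ.+-assoc (seq z n) δ δ) (cong (seq z n ℚ.+_) δ+δ≡ε)) (ℚ.+-monoˡ-< δ yz)))
      (x≤y δ 0<δ) (y≤z δ 0<δ)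

  ≤-reflexive : ∀ x y → x ≈ y → x ≤ y
  ≤-reflexive x y x≈y ε 0<ε =
    let N , close = x≈y ε 0<ε
    in N , λ n N≤n → subst₂ ℚ._<_
      (solve 2 (λ x y → y :+ (x :- y) := x) refl (seq x n) (seq y n)) refl
      (ℚ.+-monoʳ-< (seq y n) (ℚ.≤-<-trans (p≤∣p∣ (seq x n ℚ.- seq y n)) (close n N≤n)))

  +-mono-≤ : ∀ x x′ y y′ → x ≤ x′ → y ≤ y′ → x + y ≤ x′ + y′
  +-mono-≤ x x′ y y′ x≤x′ y≤y′ ε 0<ε =
    let δ , 0<δ , δ+δ≡ε = halve ε 0<ε
    in eventually₂
      (λ n xx yy → subst (seq x n ℚ.+ seq y n ℚ.<_)
        (trans (solve 3 (λ a b d → (a :+ d) :+ (b :+ d) := (a :+ b) :+ (d :+ d)) refl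
                 (seq x′ n) (seq y′ n) δ)
          (cong (seq x′ n ℚ.+ seq y′ n ℚ.+_) δ+δ≡ε))
        (ℚ.+-mono-< xx yy))
      (x≤x′ δ 0<δ) (y≤y′ δ 0<δ)

  sum-mono : ∀ {n} (x y : Fin n → ℝ) → (∀ i → x i ≤ y i) → sum x ≤ sum y
  sum-mono {zero}  x y x≤y = ≤-reflexive 0ℝ 0ℝ (≈-refl 0ℝ)
  sum-mono {suc n} x y x≤y = +-mono-≤ (x zero) (y zero) (sum (x ∘ suc)) (sum (y ∘ suc))
    (x≤y zero) (sum-mono (x ∘ suc) (y ∘ suc) (x≤y ∘ suc))

  -- A nonnegative real may have negative terms, but they are eventually above `- δ`. The deficit is
  -- then at most `(q - p) * δ`, and the extra 1 in `B` makes the inequality strict.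
  *-monoʳ-≤ : ∀ w {p q} → 0ℝ ≤ w → p ℚ.≤ q → w * fromℚ p ≤ w * fromℚ q
  *-monoʳ-≤ w {p} {q} 0≤w p≤q ε 0<ε =
    let δ , 0<δ , Bδ≡ε = divide B ε 0<B 0<ε
        N , 0<w+δ = 0≤w δ 0<δ
    in N , λ n N≤n → bound (seq w n) Bδ≡ε (0<w+δ n N≤n)
    where
    B = 1ℚ ℚ.+ (q ℚ.- p)
    0<B : 0ℚ ℚ.< B
    0<B = ℚ.+-mono-<-≤ 0<1 (0≤q-p p≤q)
    bound : ∀ a {δ} → B ℚ.* δ ≡ ε → 0ℚ ℚ.< a ℚ.+ δ → a ℚ.* p ℚ.< a ℚ.* q ℚ.+ ε
    bound a {δ} Bδ≡ε 0<a+δ = 0<q-p⇒p<q (begin-strict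
      0ℚ                                    ≡⟨ ℚ.*-zeroʳ (q ℚ.- p) ⟨
      (q ℚ.- p) ℚ.* 0ℚ                      ≤⟨ ℚ.*-monoˡ-≤-nonNeg (q ℚ.- p) {{ℚ.nonNegative (0≤q-p p≤q)}} (ℚ.<⇒≤ 0<a+δ) ⟩
      (q ℚ.- p) ℚ.* (a ℚ.+ δ)               ≡⟨ ℚ.+-identityʳ _ ⟨
      (q ℚ.- p) ℚ.* (a ℚ.+ δ) ℚ.+ 0ℚ        <⟨ ℚ.+-monoʳ-< ((q ℚ.- p) ℚ.* (a ℚ.+ δ)) 0<δ ⟩
      (q ℚ.- p) ℚ.* (a ℚ.+ δ) ℚ.+ δ
        ≡⟨ solve 4 (λ a p q d → (q :- p) :* (a :+ d) :+ d :=
             (a :* q :+ (con 1ℚ :+ (q :- p)) :* d) :- a :* p) refl a p q δ ⟩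
      (a ℚ.* q ℚ.+ B ℚ.* δ) ℚ.- a ℚ.* p     ≡⟨ cong (λ e → (a ℚ.* q ℚ.+ e) ℚ.- a ℚ.* p) Bδ≡ε ⟩
      (a ℚ.* q ℚ.+ ε) ℚ.- a ℚ.* p           ∎)
      where
      open ℚ.≤-Reasoning
      0<δ : 0ℚ ℚ.< δ
      0<δ = ℚ.*-cancelˡ-<-nonNeg B {{ℚ.nonNegative (ℚ.<⇒≤ 0<B)}}
        (subst₂ ℚ._<_ (sym (ℚ.*-zeroʳ B)) (sym Bδ≡ε) 0<ε)

open Reals

-- The cube root of 4 by bisection, and the growth rate.

module CubeRoot where
  open +-*-Solver using (solve; _:=_; _:+_; _:*_; _:-_; :-_; con)

  ν : ℕ → ℚ
  ν n = + n ℚ./ 1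

  -- Reduction to lowest terms is stuck on a variable; among unnormalised fractions the laws of `ν`
  -- become integer identities.
  toℚᵘ-ν : ∀ n → ℚ.toℚᵘ (ν n) ℚᵘ.≃ ℚᵘ.mkℚᵘ (+ n) 0
  toℚᵘ-ν n = ℚ.toℚᵘ-fromℚᵘ (ℚᵘ.mkℚᵘ (+ n) 0)

  ν-homo-* : ∀ m n → ν (m ℕ.* n) ≡ ν m ℚ.* ν n
  ν-homo-* m n = ℚ.toℚᵘ-injective (ℚᵘ.≃-trans (toℚᵘ-ν (m ℕ.* n))
    (ℚᵘ.≃-trans (ℚᵘ.*≡* (cong (ℤ._* + 1) (ℤ.pos-* m n)))
      (ℚᵘ.≃-sym (ℚᵘ.≃-trans (ℚ.toℚᵘ-homo-* (ν m) (ν n)) (ℚᵘ.*-cong (toℚᵘ-ν m) (toℚᵘ-ν n))))))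

  ν-suc : ∀ n → ν (suc n) ≡ 1ℚ ℚ.+ ν n
  ν-suc n = ℚ.toℚᵘ-injective (ℚᵘ.≃-trans (toℚᵘ-ν (suc n))
    (ℚᵘ.≃-trans (ℚᵘ.*≡* (cong (ℤ._* + 1) (cong (λ z → + 1 ℤ.+ z) (sym (ℤ.*-identityʳ (+ n))))))
      (ℚᵘ.≃-sym (ℚᵘ.≃-trans (ℚ.toℚᵘ-homo-+ 1ℚ (ν n)) (ℚᵘ.+-congʳ ℚᵘ.1ℚᵘ (toℚᵘ-ν n))))))

  i≤∣i∣ : ∀ i → i ℤ.≤ + ℤ.∣ i ∣
  i≤∣i∣ (+ n)      = ℤ.≤-refl
  i≤∣i∣ ℤ.-[1+ n ] = ℤ.-≤+

  -- Dividing by the denominator does not increase the absolute value, so that of the numerator,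
  -- plus 1, suffices.
  archimedean : ∀ p → ∃[ n ] p ℚ.< ν n
  archimedean p@(ℚ.mkℚ i d-1 _) = suc ℤ.∣ i ∣ , ℚ.toℚᵘ-cancel-<
    (ℚᵘ.<-respʳ-≃ (ℚᵘ.≃-sym (toℚᵘ-ν (suc ℤ.∣ i ∣))) (ℚᵘ.*<* (begin-strict
      i ℤ.* + 1                     ≡⟨ ℤ.*-identityʳ i ⟩
      i                             ≤⟨ i≤∣i∣ i ⟩
      + ℤ.∣ i ∣                     <⟨ ℤ.+<+ (ℕ.m≤m*n (suc ℤ.∣ i ∣) (suc d-1)) ⟩
      + (suc ℤ.∣ i ∣ ℕ.* suc d-1)   ≡⟨ ℤ.pos-* (suc ℤ.∣ i ∣) (suc d-1) ⟩
      + suc ℤ.∣ i ∣ ℤ.* + suc d-1   ∎)))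
    where open ℤ.≤-Reasoning

  ν-nonNeg : ∀ n → 0ℚ ℚ.≤ ν n
  ν-nonNeg zero    = ℚ.≤-refl
  ν-nonNeg (suc n) = subst (0ℚ ℚ.≤_) (sym (ν-suc n)) (ℚ.+-mono-≤ (ℚ.<⇒≤ 0<1) (ν-nonNeg n))

  ν≤ν-suc : ∀ n → ν n ℚ.≤ ν (suc n)
  ν≤ν-suc n = subst (ν n ℚ.≤_) (sym (ν-suc n)) (ℚ.<⇒≤ (p<1+p (ν n)))

  1≤ν-suc : ∀ n → 1ℚ ℚ.≤ ν (suc n)
  1≤ν-suc n = subst (1ℚ ℚ.≤_) (sym (ν-suc n))
    (subst (ℚ._≤ 1ℚ ℚ.+ ν n) (ℚ.+-identityʳ 1ℚ) (ℚ.+-monoʳ-≤ 1ℚ (ν-nonNeg n)))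

  0≤p*q : ∀ {p q} → 0ℚ ℚ.≤ p → 0ℚ ℚ.≤ q → 0ℚ ℚ.≤ p ℚ.* q
  0≤p*q {p} {q} 0≤p 0≤q = subst (ℚ._≤ p ℚ.* q) (ℚ.*-zeroʳ p)
    (ℚ.*-monoˡ-≤-nonNeg p {{ℚ.nonNegative 0≤p}} 0≤q)

  *-mono-≤ : ∀ {p q r s} → 0ℚ ℚ.≤ r → 0ℚ ℚ.≤ q → p ℚ.≤ q → r ℚ.≤ s → p ℚ.* r ℚ.≤ q ℚ.* s
  *-mono-≤ {p} {q} {r} {s} 0≤r 0≤q p≤q r≤s = ℚ.≤-trans
    (ℚ.*-monoʳ-≤-nonNeg r {{ℚ.nonNegative 0≤r}} p≤q)
    (ℚ.*-monoˡ-≤-nonNeg q {{ℚ.nonNegative 0≤q}} r≤s)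

  ∣-∣-within : ∀ {l h a b} → l ℚ.≤ a → a ℚ.≤ h → l ℚ.≤ b → b ℚ.≤ h → ∣ a ℚ.- b ∣ ℚ.≤ h ℚ.- l
  ∣-∣-within {l} {h} {a} {b} l≤a a≤h l≤b b≤h with ℚ.∣p∣≡p∨∣p∣≡-p (a ℚ.- b)
  ... | inj₁ eq = subst (ℚ._≤ h ℚ.- l) (sym eq) (ℚ.+-mono-≤ a≤h (ℚ.neg-antimono-≤ l≤b))
  ... | inj₂ eq = subst (ℚ._≤ h ℚ.- l)
    (trans (solve 2 (λ a b → b :- a := :- (a :- b)) refl a b) (sym eq))
    (ℚ.+-mono-≤ b≤h (ℚ.neg-antimono-≤ l≤a))

  cube : ℚ → ℚ
  cube x = x ℚ.* (x ℚ.* (x ℚ.* 1ℚ))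

  4ℚ 2ℚ : ℚ
  4ℚ = ν 4
  2ℚ = ν 2

  -- The bounds 1 and 2 supply positivity and a Lipschitz constant for cubing.
  record Bracket : Set where
    field
      lo hi  : ℚ
      lo≤hi  : lo ℚ.≤ hi
      1≤lo   : 1ℚ ℚ.≤ lo
      hi≤2   : hi ℚ.≤ 2ℚ
      lo³≤4  : cube lo ℚ.≤ 4ℚ
      4≤hi³  : 4ℚ ℚ.≤ cube hi

    mid : ℚ
    mid = ½ ℚ.* (lo ℚ.+ hi)

    width : ℚ
    width = hi ℚ.- lo

    half-width : mid ℚ.- lo ≡ ½ ℚ.* width
    half-width = solve 2 (λ l h → con ½ :* (l :+ h) :- l := con ½ :* (h :- l)) refl lo hi

    half-width′ : hi ℚ.- mid ≡ ½ ℚ.* width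
    half-width′ = solve 2 (λ l h → h :- con ½ :* (l :+ h) := con ½ :* (h :- l)) refl lo hi

    0≤half-width : 0ℚ ℚ.≤ ½ ℚ.* width
    0≤half-width = 0≤p*q (ℚ.nonNegative⁻¹ ½) (0≤q-p lo≤hi)

    lo≤mid : lo ℚ.≤ mid
    lo≤mid = 0≤q-p⇒p≤q (subst (0ℚ ℚ.≤_) (sym half-width) 0≤half-width)

    mid≤hi : mid ℚ.≤ hi
    mid≤hi = 0≤q-p⇒p≤q (subst (0ℚ ℚ.≤_) (sym half-width′) 0≤half-width)

  open Bracket

  -- The decision is an argument so that the lemmas about the new bracket can split on it.
  halveAt : (b : Bracket) → Dec (cube (mid b) ℚ.≤ 4ℚ) → Bracket
  halveAt b (yes ≤4) = record
    { lo = mid b ; hi = hi b ; lo≤hi = mid≤hi b ; 1≤lo = ℚ.≤-trans (1≤lo b) (lo≤mid b)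
    ; hi≤2 = hi≤2 b ; lo³≤4 = ≤4 ; 4≤hi³ = 4≤hi³ b }
  halveAt b (no ≰4) = record
    { lo = lo b ; hi = mid b ; lo≤hi = lo≤mid b ; 1≤lo = 1≤lo b
    ; hi≤2 = ℚ.≤-trans (mid≤hi b) (hi≤2 b) ; lo³≤4 = lo³≤4 b ; 4≤hi³ = ℚ.<⇒≤ (ℚ.≰⇒> ≰4) }

  mid³≤4? : ∀ b → Dec (cube (mid b) ℚ.≤ 4ℚ)
  mid³≤4? b = cube (mid b) ℚ.≤? 4ℚ

  lo-halveAt : ∀ b d → lo b ℚ.≤ lo (halveAt b d)
  lo-halveAt b (yes _) = lo≤mid b
  lo-halveAt b (no  _) = ℚ.≤-refl

  hi-halveAt : ∀ b d → hi (halveAt b d) ℚ.≤ hi b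
  hi-halveAt b (yes _) = ℚ.≤-refl
  hi-halveAt b (no  _) = mid≤hi b

  width-halveAt : ∀ b d → width (halveAt b d) ≡ ½ ℚ.* width b
  width-halveAt b (yes _) = half-width′ b
  width-halveAt b (no  _) = half-width b

  bracket : ℕ → Bracket
  bracket zero    = record
    { lo = lo₀ ; hi = hi₀
    ; lo≤hi = from-yes (lo₀ ℚ.≤? hi₀) ; 1≤lo = from-yes (1ℚ ℚ.≤? lo₀)
    ; hi≤2 = from-yes (hi₀ ℚ.≤? 2ℚ) ; lo³≤4 = from-yes (cube lo₀ ℚ.≤? 4ℚ)
    ; 4≤hi³ = from-yes (4ℚ ℚ.≤? cube hi₀) }
    where
    -- Four correct decimals from the outset give the numerical bounds on `∛4` directly.
    lo₀ = + 15874 ℚ./ 10000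
    hi₀ = + 158741 ℚ./ 100000
  bracket (suc n) = halveAt (bracket n) (mid³≤4? (bracket n))

  lo-mono : ∀ {m n} → m ℕ.≤′ n → lo (bracket m) ℚ.≤ lo (bracket n)
  lo-mono ℕ.≤′-refl           = ℚ.≤-refl
  lo-mono (ℕ.≤′-step {n} m≤n) = ℚ.≤-trans (lo-mono m≤n) (lo-halveAt (bracket n) (mid³≤4? (bracket n)))

  hi-antimono : ∀ {m n} → m ℕ.≤′ n → hi (bracket n) ℚ.≤ hi (bracket m)
  hi-antimono ℕ.≤′-refl           = ℚ.≤-refl
  hi-antimono (ℕ.≤′-step {n} m≤n) = ℚ.≤-trans (hi-halveAt (bracket n) (mid³≤4? (bracket n))) (hi-antimono m≤n)

  -- Halving gains at least as much as passing from `n + 1` to `n + 2` loses; this rate is enough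
  -- for convergence.
  width-bound : ∀ n → width (bracket n) ℚ.* ν (suc n) ℚ.≤ 1ℚ
  width-bound zero    = from-yes (width (bracket 0) ℚ.* ν 1 ℚ.≤? 1ℚ)
  width-bound (suc n) = ℚ.≤-trans (0≤q-p⇒p≤q (begin
      0ℚ
        ≤⟨ 0≤p*q (0≤half-width (bracket n)) (0≤q-p (1≤ν-suc n)) ⟩
      ½ ℚ.* w ℚ.* (ν (suc n) ℚ.- 1ℚ)
        ≡⟨ solve 2 (λ w y → con ½ :* w :* (y :- con 1ℚ) :=
             w :* y :- con ½ :* w :* (con 1ℚ :+ y)) refl w (ν (suc n)) ⟩
      w ℚ.* ν (suc n) ℚ.- ½ ℚ.* w ℚ.* (1ℚ ℚ.+ ν (suc n))
        ≡⟨ cong₂ (λ x y → w ℚ.* ν (suc n) ℚ.- x ℚ.* y)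
             (width-halveAt (bracket n) (mid³≤4? (bracket n))) (ν-suc (suc n)) ⟨
      w ℚ.* ν (suc n) ℚ.- width (bracket (suc n)) ℚ.* ν (suc (suc n)) ∎))
    (width-bound n)
    where
    open ℚ.≤-Reasoning
    w = width (bracket n)

  width-small : ∀ ε → 0ℚ ℚ.< ε → ∃[ N ] width (bracket N) ℚ.< ε
  width-small ε 0<ε =
    let δ , 0<δ , εδ≡1 = divide ε 1ℚ 0<ε 0<1
        N , δ<νN = archimedean δ
    in N , ℚ.*-cancelʳ-<-nonNeg (ν (suc N)) {{ℚ.nonNegative (ν-nonNeg (suc N))}} (begin-strict
      width (bracket N) ℚ.* ν (suc N)  ≤⟨ width-bound N ⟩
      1ℚ                               ≡⟨ εδ≡1 ⟨
      ε ℚ.* δ                          <⟨ ℚ.*-monoʳ-<-pos ε {{ℚ.positive 0<ε}} (ℚ.<-≤-trans δ<νN (ν≤ν-suc N)) ⟩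
      ε ℚ.* ν (suc N)                  ∎)
    where open ℚ.≤-Reasoning

  lo≤hi-bracket : ∀ {m n} → m ℕ.≤ n → lo (bracket n) ℚ.≤ hi (bracket m)
  lo≤hi-bracket {n = n} m≤n = ℚ.≤-trans (lo≤hi (bracket n)) (hi-antimono (ℕ.≤⇒≤′ m≤n))

  -- From index `N` on, the lower ends stay inside bracket `N`, whose width is small.
  ∛4 : ℝ
  ∛4 = mkℝ (λ n → lo (bracket n)) λ ε 0<ε →
    let N , small = width-small ε 0<ε
    in N , λ m n N≤m N≤n → ℚ.≤-<-trans
      (∣-∣-within (lo-mono (ℕ.≤⇒≤′ N≤m)) (lo≤hi-bracket N≤m)
                  (lo-mono (ℕ.≤⇒≤′ N≤n)) (lo≤hi-bracket N≤n)) small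

  -- In the factorisation of a difference of cubes, each of the three products is at most 4.
  cube-gap : ∀ b → cube (hi b) ℚ.- cube (lo b) ℚ.≤ ν 12 ℚ.* width b
  cube-gap b = begin
    cube (hi b) ℚ.- cube (lo b)
      ≡⟨ solve 2 (λ l h → h :* (h :* (h :* con 1ℚ)) :- l :* (l :* (l :* con 1ℚ)) :=
           (h :* h :+ h :* l :+ l :* l) :* (h :- l)) refl (lo b) (hi b) ⟩
    (hi b ℚ.* hi b ℚ.+ hi b ℚ.* lo b ℚ.+ lo b ℚ.* lo b) ℚ.* width b
      ≤⟨ ℚ.*-monoʳ-≤-nonNeg (width b) {{ℚ.nonNegative (0≤q-p (lo≤hi b))}}
           (ℚ.+-mono-≤ (ℚ.+-mono-≤ (prod 0≤hi (hi≤2 b) (hi≤2 b)) (prod 0≤lo (hi≤2 b) lo≤2))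
             (prod 0≤lo lo≤2 lo≤2)) ⟩
    ν 12 ℚ.* width b ∎
    where
    open ℚ.≤-Reasoning
    0≤lo : 0ℚ ℚ.≤ lo b
    0≤lo = ℚ.≤-trans (ℚ.<⇒≤ 0<1) (1≤lo b)
    0≤hi : 0ℚ ℚ.≤ hi b
    0≤hi = ℚ.≤-trans 0≤lo (lo≤hi b)
    lo≤2 : lo b ℚ.≤ 2ℚ
    lo≤2 = ℚ.≤-trans (lo≤hi b) (hi≤2 b)
    prod : ∀ {x y} → 0ℚ ℚ.≤ y → x ℚ.≤ 2ℚ → y ℚ.≤ 2ℚ → x ℚ.* y ℚ.≤ 4ℚ
    prod 0≤y = *-mono-≤ 0≤y (ν-nonNeg 2)

  -- Both 4 and the cube of the lower end lie between the cubes of the two ends, whose distance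
  -- tends to 0.
  ∛4³≈4 : ∛4 ^ 3 ≈ fromℕ 4
  ∛4³≈4 ε 0<ε =
    let δ , 0<δ , 12δ≡ε = divide (ν 12) ε (ℚ.positive⁻¹ (ν 12)) 0<ε
        N , small = width-small δ 0<δ
    in N , λ n N≤n → begin-strict
      ∣ cube (lo (bracket n)) ℚ.- 4ℚ ∣
        ≤⟨ ∣-∣-within ℚ.≤-refl (ℚ.≤-trans (lo³≤4 (bracket n)) (4≤hi³ (bracket n)))
             (lo³≤4 (bracket n)) (4≤hi³ (bracket n)) ⟩
      cube (hi (bracket n)) ℚ.- cube (lo (bracket n))
        ≤⟨ cube-gap (bracket n) ⟩
      ν 12 ℚ.* width (bracket n)
        ≤⟨ ℚ.*-monoˡ-≤-nonNeg (ν 12) (ℚ.+-mono-≤ (hi-antimono (ℕ.≤⇒≤′ N≤n))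
             (ℚ.neg-antimono-≤ (lo-mono (ℕ.≤⇒≤′ N≤n)))) ⟩
      ν 12 ℚ.* width (bracket N)
        <⟨ ℚ.*-monoʳ-<-pos (ν 12) small ⟩
      ν 12 ℚ.* δ
        ≡⟨ 12δ≡ε ⟩
      ε ∎
    where open ℚ.≤-Reasoning

  lowerBound : fromℚ (+ 15874 ℚ./ 10000) ≤ ∛4
  lowerBound = pointwise-≤ (fromℚ (+ 15874 ℚ./ 10000)) ∛4 λ n → lo-mono {0} {n} ℕ.z≤′n

  upperBound : ∛4 < fromℚ (+ 15875 ℚ./ 10000)
  -- A rational strictly between the first upper end 1.58741 and the claimed bound 1.5875.
  upperBound = <-of-bound {q = + 158745 ℚ./ 100000} ∛4
    (from-yes (hi (bracket 0) ℚ.<? + 158745 ℚ./ 100000))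
    (from-yes (+ 158745 ℚ./ 100000 ℚ.<? + 15875 ℚ./ 10000)) λ n → lo≤hi-bracket {0} {n} z≤n

  0<∛4 : 0ℝ < ∛4
  0<∛4 = 1ℚ , 0<1 , 0 , λ n _ → ℚ.<-≤-trans
    (from-yes (0ℚ ℚ.+ 1ℚ ℚ.<? lo (bracket 0))) (lo-mono {0} {n} ℕ.z≤′n)

  0≤power : ∀ d n → 0ℚ ℚ.≤ seq (∛4 ^ d) n
  0≤power zero    n = ℚ.<⇒≤ 0<1
  0≤power (suc d) n = 0≤p*q (ℚ.≤-trans (ℚ.<⇒≤ 0<1) (1≤lo (bracket n))) (0≤power d n)

  -- Three factors contribute at most 4, since the cube of `lo` does not exceed 4; the up to two
  -- left over are at most 2 each, which the leading 4 absorbs.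
  power≤ : ∀ d n → seq (∛4 ^ d) n ℚ.≤ 4ℚ ℚ.* ν (4 ℕ.^ (d / 3))
  power≤ 0 n = from-yes (1ℚ ℚ.≤? 4ℚ ℚ.* ν 1)
  power≤ 1 n = ℚ.≤-trans (ℚ.≤-reflexive (ℚ.*-identityʳ (lo (bracket n))))
    (ℚ.≤-trans (lo≤hi (bracket n)) (ℚ.≤-trans (hi≤2 (bracket n)) (from-yes (2ℚ ℚ.≤? 4ℚ ℚ.* ν 1))))
  power≤ 2 n = ℚ.≤-trans (ℚ.≤-reflexive (cong (lo (bracket n) ℚ.*_) (ℚ.*-identityʳ (lo (bracket n)))))
    (ℚ.≤-trans (*-mono-≤ (ℚ.≤-trans (ℚ.<⇒≤ 0<1) (1≤lo (bracket n))) (ν-nonNeg 2) lo≤2 lo≤2)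
      (from-yes (2ℚ ℚ.* 2ℚ ℚ.≤? 4ℚ ℚ.* ν 1)))
    where
    lo≤2 : lo (bracket n) ℚ.≤ 2ℚ
    lo≤2 = ℚ.≤-trans (lo≤hi (bracket n)) (hi≤2 (bracket n))
  power≤ (suc (suc (suc d))) n = begin
    x ℚ.* (x ℚ.* (x ℚ.* y))
      ≡⟨ solve 2 (λ x y → x :* (x :* (x :* y)) := x :* (x :* (x :* con 1ℚ)) :* y) refl x y ⟩
    cube x ℚ.* y
      ≤⟨ *-mono-≤ (0≤power d n) (ν-nonNeg 4) (lo³≤4 (bracket n)) (power≤ d n) ⟩
    4ℚ ℚ.* (4ℚ ℚ.* ν (4 ℕ.^ (d / 3)))
      ≡⟨ cong (4ℚ ℚ.*_) (ν-homo-* 4 (4 ℕ.^ (d / 3))) ⟨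
    4ℚ ℚ.* ν (4 ℕ.^ suc (d / 3))
      ≡⟨ cong (λ k → 4ℚ ℚ.* ν (4 ℕ.^ k)) (+-distrib-/-∣ˡ {3} d ∣-refl) ⟨
    4ℚ ℚ.* ν (4 ℕ.^ ((3 ℕ.+ d) / 3)) ∎
    where
    open ℚ.≤-Reasoning
    x = lo (bracket n)
    y = seq (∛4 ^ d) n

  ¼*power≤ : ∀ d → fromℚ (+ 1 ℚ./ 4) * ∛4 ^ d ≤ fromℕ (4 ℕ.^ (d / 3))
  ¼*power≤ d = pointwise-≤ (fromℚ (+ 1 ℚ./ 4) * ∛4 ^ d) (fromℕ (4 ℕ.^ (d / 3))) λ n → begin
    + 1 ℚ./ 4 ℚ.* seq (∛4 ^ d) n
      ≤⟨ ℚ.*-monoˡ-≤-nonNeg (+ 1 ℚ./ 4) (power≤ d n) ⟩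
    + 1 ℚ./ 4 ℚ.* (4ℚ ℚ.* ν (4 ℕ.^ (d / 3)))
      ≡⟨ ℚ.*-assoc (+ 1 ℚ./ 4) 4ℚ (ν (4 ℕ.^ (d / 3))) ⟨
    1ℚ ℚ.* ν (4 ℕ.^ (d / 3))
      ≡⟨ ℚ.*-identityˡ (ν (4 ℕ.^ (d / 3))) ⟩
    ν (4 ℕ.^ (d / 3)) ∎
    where open ℚ.≤-Reasoning

open CubeRoot

-- From separating functions to a strictly antipodal set of points.

module Realisation {M d} (S : Frame M d) (separating : Separating (coord S)) where
  open +-*-Solver using (solve; _:=_; _:+_; _:*_; _:-_; con)

  point : Fin (suc M) → Point d
  point w j = fromℚ (coord S j w)

  X : PointSet d
  X = range point

  point∈X : ∀ w → point w ∈ X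
  point∈X w = w , λ j → ≈-refl (point w j)

  embed : (Fin d → ℚ) → Point d
  embed a j = fromℚ (a j)

  linear : (Fin d → ℚ) → Fn (suc M)
  linear a w = ∑ (λ j → a j ℚ.* coord S j w)

  -- The constant term of the affine form cancels in every comparison.
  separatingDirection : ∀ u v → u ≢ v → ∃[ a ] Separates (linear a) u v
  separatingDirection u v u≢v =
    let h , h∈ , sep = separating u v u≢v
        c , a , h≡ = affineForm h∈
        cancel : ∀ {w w′} → h w ℚ.< h w′ → linear a w ℚ.< linear a w′
        cancel {w} {w′} hw<hw′ = 0<q-p⇒p<q (subst (0ℚ ℚ.<_)
          (trans (cong₂ ℚ._-_ (h≡ w′) (h≡ w))
            (solve 3 (λ c x y → (c :+ x) :- (c :+ y) := x :- y) refl c (linear a w′) (linear a w)))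
          (0<q-p hw<hw′))
    in a , record
      { minimal = λ w w≢u → cancel (minimal sep w w≢u)
      ; maximal = λ w w≢v → cancel (maximal sep w w≢v) }

  ⟨embed,point⟩ : ∀ a w → ⟨ embed a , point w ⟩ ≈ fromℚ (linear a w)
  ⟨embed,point⟩ a w = pointwise-≈ ⟨ embed a , point w ⟩ (fromℚ (linear a w)) λ n →
    seq-sum (λ j → embed a j * point w j) n

  point-injective : ∀ {u v} → point u ≈ᵖ point v → u ≡ v
  point-injective {u} {v} pu≈pv = decidable-stable (u Fin.≟ v) λ u≢v →
    let a , sep = separatingDirection u v u≢v
    in ℚ.<-irrefl (sum-cong-≗ (λ j → cong (a j ℚ.*_) (fromℚ-injective (pu≈pv j))))
         (maximal sep u u≢v)

  hasCardinality : HasCardinality X (suc M)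
  hasCardinality = point , point-injective , id , id

  -- By the frame conditions `zero` lies at the origin and the nodes are the standard basis vectors.
  -- So the coordinates of `q` serve as weights, and the origin takes the remaining weight.
  affinelySpanning : AffinelySpanning X
  affinelySpanning q = suc d , w , p , (λ { zero → point∈X zero ; (suc i) → point∈X (node S i) })
    , pointwise-≈ (sum w) 1ℝ sum-w
    , λ j → pointwise-≈ (q j) (combination w p j) (combination-w j)
    where
    w : Fin (suc d) → ℝ
    w zero    = 1ℝ + fromℚ (ℚ.- 1ℚ) * sum q
    w (suc i) = q i
    p : Fin (suc d) → Point d
    p zero    = point zero
    p (suc i) = point (node S i)
    sum-w : ∀ n → seq (sum w) n ≡ 1ℚ
    sum-w n = solve 1 (λ x → (con 1ℚ :+ con (ℚ.- 1ℚ) :* x) :+ x := con 1ℚ) refl (seq (sum q) n)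
    combination-w : ∀ j n → seq (q j) n ≡ seq (combination w p j) n
    combination-w j n = sym (begin
      seq (w zero) n ℚ.* coord S j zero ℚ.+ seq (sum (λ i → q i * point (node S i) j)) n
        ≡⟨ cong₂ ℚ._+_ (trans (cong (seq (w zero) n ℚ.*_) (coord-zero S j)) (ℚ.*-zeroʳ (seq (w zero) n)))
             (seq-sum (λ i → q i * point (node S i) j) n) ⟩
      0ℚ ℚ.+ ∑ (λ i → seq (q i) n ℚ.* coord S j (node S i))
        ≡⟨ ℚ.+-identityˡ _ ⟩
      ∑ (λ i → seq (q i) n ℚ.* coord S j (node S i))
        ≡⟨ sum-cong-≗ (λ i → cong (seq (q i) n ℚ.*_) (trans (coord-node S j i) (δ-comm j i))) ⟩
      ∑ (λ i → seq (q i) n ℚ.* δ i j)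
        ≡⟨ ∑-δ (λ i → seq (q i) n) j ⟩
      seq (q j) n ∎)
      where open ≡-Reasoning

  ⟨⟩-cong : ∀ (a p q : Point d) → p ≈ᵖ q → ⟨ a , p ⟩ ≈ ⟨ a , q ⟩
  ⟨⟩-cong a p q p≈q = sum-cong (λ j → a j * p j) (λ j → a j * q j)
    (λ j → *-congˡ (a j) (p j) (q j) (p≈q j))

  ⟨⟩-near-point : ∀ a p w → p ≈ᵖ point w → ⟨ embed a , p ⟩ ≈ fromℚ (linear a w)
  ⟨⟩-near-point a p w p≈w = ≈-trans ⟨ embed a , p ⟩ ⟨ embed a , point w ⟩ (fromℚ (linear a w))
    (⟨⟩-cong (embed a) p (point w) p≈w) (⟨embed,point⟩ a w)

  ⟨⟩-combination : ∀ {m} a (w : Fin m → ℝ) (k : Fin m → Fin (suc M)) →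
    ⟨ embed a , combination w (point ∘ k) ⟩ ≈ sum (λ i → w i * fromℚ (linear a (k i)))
  ⟨⟩-combination a w k = pointwise-≈ ⟨ embed a , combination w (point ∘ k) ⟩
    (sum (λ i → w i * fromℚ (linear a (k i)))) λ n → begin
    seq ⟨ embed a , combination w (point ∘ k) ⟩ n
      ≡⟨ seq-sum (λ j → embed a j * combination w (point ∘ k) j) n ⟩
    ∑ (λ j → a j ℚ.* seq (combination w (point ∘ k) j) n)
      ≡⟨ sum-cong-≗ (λ j → trans
           (cong (a j ℚ.*_) (seq-sum (λ i → w i * point (k i) j) n))
           (*-distribˡ-sum (a j) (λ i → seq (w i) n ℚ.* coord S j (k i)))) ⟩
    ∑ (λ j → ∑ (λ i → a j ℚ.* (seq (w i) n ℚ.* coord S j (k i))))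
      ≡⟨ ∑-comm (λ j i → a j ℚ.* (seq (w i) n ℚ.* coord S j (k i))) ⟩
    ∑ (λ i → ∑ (λ j → a j ℚ.* (seq (w i) n ℚ.* coord S j (k i))))
      ≡⟨ sum-cong-≗ (λ i → trans
           (sum-cong-≗ (λ j → solve 3 (λ a w x → a :* (w :* x) := w :* (a :* x)) refl
             (a j) (seq (w i) n) (coord S j (k i))))
           (sym (*-distribˡ-sum (seq (w i) n) (λ j → a j ℚ.* coord S j (k i))))) ⟩
    ∑ (λ i → seq (w i) n ℚ.* linear a (k i))
      ≡⟨ seq-sum (λ i → w i * fromℚ (linear a (k i))) n ⟨
    seq (sum (λ i → w i * fromℚ (linear a (k i)))) n ∎
    where open ≡-Reasoning

  module _ (a : Fin d → ℚ) (b : ℚ) where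

    private
      sum-w* : ∀ {m} (w : Fin m → ℝ) → sum w ≈ 1ℝ → sum (λ i → w i * fromℚ b) ≈ fromℚ b
      sum-w* w sum≈1 = ≈-trans (sum (λ i → w i * fromℚ b)) (sum w * fromℚ b) (fromℚ b)
        (pointwise-≈ (sum (λ i → w i * fromℚ b)) (sum w * fromℚ b) λ n →
          trans (seq-sum (λ i → w i * fromℚ b) n) (trans
            (sym (*-distribʳ-sum b (λ i → seq (w i) n)))
            (cong (ℚ._* b) (sym (seq-sum w n)))))
        (≈-trans (sum w * fromℚ b) (1ℝ * fromℚ b) (fromℚ b)
          (*-congʳ (fromℚ b) (sum w) 1ℝ sum≈1)
          (pointwise-≈ (1ℝ * fromℚ b) (fromℚ b) λ _ → ℚ.*-identityˡ b))

      -- Members of `X` equal values of `point` only up to `_≈ᵖ_`, so they are replaced by these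
      -- before the sums are exchanged.
      toCombination : ∀ {q m} {w : Fin m → ℝ} {p : Fin m → Point d} (p∈X : ∀ i → p i ∈ X) →
        q ≈ᵖ combination w p →
        ⟨ embed a , q ⟩ ≈ sum (λ i → w i * fromℚ (linear a (proj₁ (p∈X i))))
      toCombination {q} {m} {w} {p} p∈X q≈ =
        ≈-trans ⟨ embed a , q ⟩ ⟨ embed a , combination w p′ ⟩
          (sum (λ i → w i * fromℚ (linear a (proj₁ (p∈X i)))))
          (⟨⟩-cong (embed a) q (combination w p′) λ j →
            ≈-trans (q j) (combination w p j) (combination w p′ j) (q≈ j)
              (sum-cong (λ i → w i * p i j) (λ i → w i * p′ i j)
                (λ i → *-congˡ (w i) (p i j) (p′ i j) (proj₂ (p∈X i) j))))
          (⟨⟩-combination a w (proj₁ ∘ p∈X))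
        where
        p′ : Fin m → Point d
        p′ i = point (proj₁ (p∈X i))

    -- The value at a convex combination is a weighted mean of the values at points of `X`.
    conv-≤ : (∀ w → linear a w ℚ.≤ b) → ∀ {q} → q ∈ conv X → ⟨ embed a , q ⟩ ≤ fromℚ b
    conv-≤ ≤b {q} (m , w , p , p∈X , 0≤w , sum≈1 , q≈) =
      ≤-trans ⟨ embed a , q ⟩ (sum values) (fromℚ b)
        (≤-reflexive ⟨ embed a , q ⟩ (sum values) (toCombination {q} {m} {w} {p} p∈X q≈))
        (≤-trans (sum values) (sum bounds) (fromℚ b)
          (sum-mono values bounds λ i → *-monoʳ-≤ (w i) (0≤w i) (≤b (proj₁ (p∈X i))))
          (≤-reflexive (sum bounds) (fromℚ b) (sum-w* w sum≈1)))
      where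
      values bounds : Fin m → ℝ
      values i = w i * fromℚ (linear a (proj₁ (p∈X i)))
      bounds i = w i * fromℚ b

    ≤-conv : (∀ w → b ℚ.≤ linear a w) → ∀ {q} → q ∈ conv X → fromℚ b ≤ ⟨ embed a , q ⟩
    ≤-conv b≤ {q} (m , w , p , p∈X , 0≤w , sum≈1 , q≈) =
      ≤-trans (fromℚ b) (sum bounds) ⟨ embed a , q ⟩
        (≤-reflexive (fromℚ b) (sum bounds) (≈-sym (sum bounds) (fromℚ b) (sum-w* w sum≈1)))
        (≤-trans (sum bounds) (sum values) ⟨ embed a , q ⟩
          (sum-mono bounds values λ i → *-monoʳ-≤ (w i) (0≤w i) (b≤ (proj₁ (p∈X i))))
          (≤-reflexive (sum values) ⟨ embed a , q ⟩
            (≈-sym ⟨ embed a , q ⟩ (sum values) (toCombination {q} {m} {w} {p} p∈X q≈))))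
      where
      values bounds : Fin m → ℝ
      values i = w i * fromℚ (linear a (proj₁ (p∈X i)))
      bounds i = w i * fromℚ b

  point∈conv : ∀ w → point w ∈ conv X
  point∈conv w = 1 , (λ _ → 1ℝ) , (λ _ → point w) , (λ _ → point∈X w)
    , (λ _ → pointwise-≤ 0ℝ 1ℝ λ _ → ℚ.<⇒≤ 0<1)
    , pointwise-≈ (sum {1} (λ _ → 1ℝ)) 1ℝ (λ _ → ℚ.+-identityʳ 1ℚ)
    , λ j → pointwise-≈ (point w j) (combination {m = 1} (λ _ → 1ℝ) (λ _ → point w) j) λ _ →
        sym (trans (ℚ.+-identityʳ (1ℚ ℚ.* coord S j w)) (ℚ.*-identityˡ (coord S j w)))

  module _ {u v} (u≢v : u ≢ v) (a : Fin d → ℚ) (sep : Separates (linear a) u v) where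

    private
      -- A zero vector would give `u` and `v` the same value.
      nonzeroEntry : ∃[ i ] a i ≢ 0ℚ
      nonzeroEntry with Fin.any? (λ i → ¬? (a i ℚ.≟ 0ℚ))
      ... | yes found = found
      ... | no ¬found = contradiction (minimal sep v (u≢v ∘ sym))
        (ℚ.<-irrefl (trans (vanishes u) (sym (vanishes v))))
        where
        vanishes : ∀ w → linear a w ≡ 0ℚ
        vanishes w = ∑-zero λ j → trans
          (cong (ℚ._* coord S j w) (decidable-stable (a j ℚ.≟ 0ℚ) λ ≢0 → ¬found (j , ≢0)))
          (ℚ.*-zeroˡ (coord S j w))

    level : Fin (suc M) → Hyperplane d
    level w = record
      { normal = embed a
      ; offset = fromℚ (linear a w)
      ; nonzero = let i , aᵢ≢0 = nonzeroEntry in i , sign aᵢ≢0 }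
      where
      sign : ∀ {x} → x ≢ 0ℚ → fromℚ x < 0ℝ ⊎ 0ℝ < fromℚ x
      sign {x} x≢0 with ℚ.<-cmp x 0ℚ
      ... | tri< x<0 _ _ = inj₁ (fromℚ-mono-< x<0)
      ... | tri≈ _ x≡0 _ = contradiction x≡0 x≢0
      ... | tri> _ _ 0<x = inj₂ (fromℚ-mono-< 0<x)

    minimal-≤ : ∀ w → linear a u ℚ.≤ linear a w
    minimal-≤ w with w Fin.≟ u
    ... | yes refl = ℚ.≤-refl
    ... | no  w≢u  = ℚ.<⇒≤ (minimal sep w w≢u)

    maximal-≤ : ∀ w → linear a w ℚ.≤ linear a v
    maximal-≤ w with w Fin.≟ v
    ... | yes refl = ℚ.≤-refl
    ... | no  w≢v  = ℚ.<⇒≤ (maximal sep w w≢v)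

    -- Equal real levels mean equal rational values by `fromℚ-injective`, and by `unique` only the
    -- index `t` attains this one.
    X∩level : ∀ {z} t → z ≈ᵖ point t → (∀ w → w ≢ t → linear a w ≢ linear a t) →
      (X ∩ points (level t)) ≐ singleton z
    X∩level {z} t z≈t unique =
      (λ {p} ((w , p≈w) , onLevel) j →
        ≈-trans (p j) (point w j) (z j) (p≈w j)
          (subst (λ w → point w j ≈ z j)
            (sym (decidable-stable (w Fin.≟ t) λ w≢t → unique w w≢t (fromℚ-injective
              (≈-trans (fromℚ (linear a w)) ⟨ embed a , p ⟩ (fromℚ (linear a t))
                (≈-sym ⟨ embed a , p ⟩ (fromℚ (linear a w)) (⟨⟩-near-point a p w p≈w))
                onLevel))))
            (≈-sym (z j) (point t j) (z≈t j))))
      , λ {p} p≈z →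
        let p≈t : p ≈ᵖ point t
            p≈t j = ≈-trans (p j) (z j) (point t j) (p≈z j) (z≈t j)
        in (t , p≈t) , ⟨⟩-near-point a p t p≈t

    strictlyAntipodalPair : ∀ x y → x ≈ᵖ point u → y ≈ᵖ point v → StrictlyAntipodalPair X x y
    strictlyAntipodalPair x y x≈u y≈v =
      level u , level v
      -- If the hyperplanes coincided, `point u` would lie on both, although their levels differ.
      , (λ (u⊆v , _) → ℚ.<⇒≢ (minimal sep v (u≢v ∘ sym)) (fromℚ-injective
          (≈-trans (fromℚ (linear a u)) ⟨ embed a , point u ⟩ (fromℚ (linear a v))
            (≈-sym ⟨ embed a , point u ⟩ (fromℚ (linear a u)) (⟨embed,point⟩ a u))
            (u⊆v {point u} (⟨embed,point⟩ a u)))))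
      , (1ℝ , λ i → pointwise-≈ (embed a i) (1ℝ * embed a i) λ _ → sym (ℚ.*-identityˡ (a i)))
      , ((point u , point∈conv u , ⟨embed,point⟩ a u)
        , inj₂ λ {q} → ≤-conv a (linear a u) minimal-≤ {q})
      , ((point v , point∈conv v , ⟨embed,point⟩ a v)
        , inj₁ λ {q} → conv-≤ a (linear a v) maximal-≤ {q})
      , X∩level {x} u x≈u (λ w w≢u eq → ℚ.<⇒≢ (minimal sep w w≢u) (sym eq))
      , X∩level {y} v y≈v (λ w w≢v → ℚ.<⇒≢ (maximal sep w w≢v))

  strictlyAntipodal : StrictlyAntipodal X
  strictlyAntipodal x y (u , x≈u) (v , y≈v) x≉y =
    let a , sep = separatingDirection u v u≢v
    in strictlyAntipodalPair u≢v a sep x y x≈u y≈v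
    where
    u≢v : u ≢ v
    u≢v refl = x≉y λ j → ≈-trans (x j) (point u j) (y j) (x≈u j) (≈-sym (y j) (point u j) (y≈v j))

SpanningAntipodal : ℕ → ℕ → Set₁
SpanningAntipodal d n = ∃[ X ] (HasCardinality {d} X n × AffinelySpanning X × StrictlyAntipodal X)

-- Separation passes to the frame, whose span contains every function spanned by `F`. A frame of `d`
-- coordinates takes `d + 1` points, whence `d < N`.
realise : ∀ {N m d} (F : Fin m → Fn N) → Separating F → m ℕ.≤ d → d ℕ.< N → SpanningAntipodal d N
realise {suc M} {d = d} F separating m≤d (s≤s d≤M) =
  X S sep , hasCardinality S sep , affinelySpanning S sep , strictlyAntipodal S sep
  where
  open Realisation
  S = proj₁ (frameOfSize m≤d d≤M F)
  sep : Separating (coord S)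
  sep u v u≢v =
    let h , h∈F , h-separates = separating u v u≢v
    in h , Span-bind (proj₂ (frameOfSize m≤d d≤M F)) h∈F , h-separates

-- The vertices of a simplex.

module Simplex (d : ℕ) where
  open +-*-Solver using (solve; _:=_; _:+_; _:*_; con)

  indicator : Fin d → Fn (suc d)
  indicator j = δ (suc j)

  ∑-δ≡1 : ∀ {n} (w : Fin n) → ∑ (λ j → δ j w) ≡ 1ℚ
  ∑-δ≡1 w = trans (sum-cong-≗ (λ j → sym (ℚ.*-identityˡ (δ j w)))) (∑-δ (λ _ → 1ℚ) w)

  -- The missing indicator, that of `zero`, is 1 minus the sum of the others.
  δ∈Span : ∀ u → Span indicator (δ u)
  δ∈Span (suc j) = gen j
  δ∈Span zero    = resp
    (λ w → trans (cong (ℚ._+ (ℚ.- 1ℚ) ℚ.* ∑ (λ j → δ (suc j) w)) (sym (∑-δ≡1 w)))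
      (solve 2 (λ x y → (x :+ y) :+ con (ℚ.- 1ℚ) :* y := x) refl (δ zero w) (∑ (λ j → δ (suc j) w))))
    (const 1ℚ ⊕ (ℚ.- 1ℚ) ⊙ Span-∑ indicator gen)

  0≤δ : ∀ {n} (i j : Fin n) → 0ℚ ℚ.≤ δ i j
  0≤δ zero    zero    = ℚ.<⇒≤ 0<1
  0≤δ zero    (suc j) = ℚ.≤-refl
  0≤δ (suc i) zero    = ℚ.≤-refl
  0≤δ (suc i) (suc j) = 0≤δ i j

  -- The difference of the two indicators is -1 at `u`, 1 at `v` and 0 elsewhere.
  indicator-separating : Separating indicator
  indicator-separating u v u≢v = h , δ∈Span v ⊕ (ℚ.- 1ℚ) ⊙ δ∈Span u , record
    { minimal = λ w w≢u → subst₂ ℚ._<_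
        (sym (value (δ-off (u≢v ∘ sym)) (δ-diag u)))
        (sym (value refl (δ-off (w≢u ∘ sym))))
        (ℚ.+-mono-≤-< (0≤δ v w) (from-yes ((ℚ.- 1ℚ) ℚ.* 1ℚ ℚ.<? (ℚ.- 1ℚ) ℚ.* 0ℚ)))
    ; maximal = λ w w≢v → subst₂ ℚ._<_
        (sym (value (δ-off (w≢v ∘ sym)) refl))
        (sym (value (δ-diag v) (δ-off u≢v)))
        (ℚ.+-mono-<-≤ 0<1 (ℚ.*-monoˡ-≤-nonPos (ℚ.- 1ℚ) (0≤δ u w))) }
    where
    h : Fn (suc d)
    h w = δ v w ℚ.+ (ℚ.- 1ℚ) ℚ.* δ u w
    value : ∀ {w x y} → δ v w ≡ x → δ u w ≡ y → h w ≡ x ℚ.+ (ℚ.- 1ℚ) ℚ.* y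
    value refl refl = refl

-- The choice between words and simplex, and the conclusion.

largeAntipodalSet : ∀ d → ∃[ X ] ∃[ n ] ( HasCardinality {d} X n
  × 4 ℕ.^ (d / 3) ℕ.≤ n
  × (d ℕ.< 4 ℕ.^ (d / 3) → n ≡ 4 ℕ.^ (d / 3))
  × AffinelySpanning X
  × StrictlyAntipodal X )
largeAntipodalSet d with d ℕ.<? 4 ℕ.^ (d / 3)
... | yes d<4^k =
  -- The words use `3 ⌊d/3⌋` functions, at most `d`; the frame brings the number of coordinates to
  -- exactly `d`.
  let F , separating = separatingCoordinates (d / 3)
      X , card , spanning , antipodal = realise F separating (m/n*n≤m d 3) d<4^k
  in X , 4 ℕ.^ (d / 3) , card , ℕ.≤-refl , (λ _ → refl) , spanning , antipodal
-- Here `4 ^ ⌊d/3⌋` is at most `d`, too few points to span, while the simplex has `d + 1`.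
... | no d≮4^k =
  let X , card , spanning , antipodal =
        realise (Simplex.indicator d) (Simplex.indicator-separating d) ℕ.≤-refl ℕ.≤-refl
  in X , suc d , card , ℕ.m≤n⇒m≤1+n (ℕ.≮⇒≥ d≮4^k) , (λ d<4^k → contradiction d<4^k d≮4^k) ,
     spanning , antipodal

theorem3 : ∃[ ∛4 ] ( 0ℝ < ∛4 × ∛4 ^ 3 ≈ fromℕ 4
    × fromℚ (+ 15874 ℚ./ 10000) ≤ ∛4 × ∛4 < fromℚ (+ 15875 ℚ./ 10000)
    × ∃[ const ] ( 0ℝ < const ×
    (∀ d → 2 ℕ.≤ d →
    (∃[ X ] ∃[ n ] ( HasCardinality {d} X n
    × 4 ℕ.^ (d / 3) ℕ.≤ n
    × (d ℕ.< 4 ℕ.^ (d / 3) → n ≡ 4 ℕ.^ (d / 3))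
    × AffinelySpanning X
    × StrictlyAntipodal X ))
    × const * ∛4 ^ d ≤ fromℕ (4 ℕ.^ (d / 3)) )))
theorem3 = ∛4 , 0<∛4 , ∛4³≈4 , lowerBound , upperBound ,
  -- The factor ¼ offsets the 4 that `power≤` spends on the remainder of `d` modulo 3.
  fromℚ (+ 1 ℚ./ 4) , fromℚ-mono-< (ℚ.positive⁻¹ (+ 1 ℚ./ 4)) ,
  λ d _ → largeAntipodalSet d , ¼*power≤ d
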